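{- In the graceful game, Bob has a winning strategy on every hypercube $Q_n$ with $n\geq 2$ (no matter who starts).
   Context: The hypercube $Q_n$ is defined by $Q_1=K_2$ and $Q_n=K_2\,\square\, Q_{n-1}$ (Cartesian product); it is bipartite, $n$-regular, with $2^n$ vertices and $n2^{n-1}$ edges. A graceful labeling of a graph $G$ with $m$ edges is an injective map $f\colon V(G)\to\{0,1,\dots,m\}$ such that the induced edge labels $|f(u)-f(v)|$, $uv\in E(G)$, are pairwise distinct. The graceful game on a simple graph $G$ with $m$ edges: two players, Alice and Bob, alternately choose a free (not yet labeled) vertex and assign to it a label from $\{0,1,\dots,m\}$ not yet used. An edge both of whose endpoints are labeled gets label $|f(u)-f(v)|$; a move is legal only if after it all edge labels are pairwise distinct. Alice wins if the whole graph ends up gracefully labeled; Bob wins if he can prevent this. Either player may be the first to move. -}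

module Defs where

open import Data.Nat using (ℕ; _*_; _^_; _∸_; _≤_; ∣_-_∣)
open import Data.Bool using (Bool)
open import Data.Bool.Properties using () renaming (_≟_ to _≟B_)
open import Data.Vec using (Vec; _∷_; [])
open import Data.Vec.Properties using (≡-dec)
open import Data.Maybe using (Maybe; just; nothing)
open import Data.Product using (_×_)
open import Data.Sum using (_⊎_)
open import Relation.Nullary using (¬_; yes; no)
open import Relation.Binary.PropositionalEquality using (_≡_; _≢_)

Vertex : ℕ → Set
Vertex n = Vec Bool n

-- Adjacency in Q_n, following Q_n = K_2 □ Q_{n-1}:
-- (x,u) ~ (y,v) iff (x ≠ y and u = v) or (x = y and u ~ v).
data Adj : ∀ {n} → Vertex n → Vertex n → Set where
  here  : ∀ {n} {x y : Bool} {u : Vertex n} → x ≢ y → Adj (x ∷ u) (y ∷ u)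
  there : ∀ {n} {x : Bool} {u v : Vertex n} → Adj u v → Adj (x ∷ u) (x ∷ v)

edges : ℕ → ℕ
edges n = n * 2 ^ (n ∸ 1)

Labeling : ℕ → Set
Labeling n = Vertex n → Maybe ℕ

empty : ∀ {n} → Labeling n
empty _ = nothing

_≟V_ : ∀ {n} (u v : Vertex n) → Relation.Nullary.Dec (u ≡ v)
_≟V_ = ≡-dec _≟B_

update : ∀ {n} → Labeling n → Vertex n → ℕ → Labeling n
update f v ℓ w with w ≟V v
... | yes _ = just ℓ
... | no  _ = f w

DistinctEdgeLabels : ∀ {n} → Labeling n → Set
DistinctEdgeLabels {n} f =
  ∀ (u v u′ v′ : Vertex n) (a b a′ b′ : ℕ) →
  Adj u v → Adj u′ v′ →
  f u ≡ just a → f v ≡ just b → f u′ ≡ just a′ → f v′ ≡ just b′ →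
  ∣ a - b ∣ ≡ ∣ a′ - b′ ∣ →
  (u ≡ u′ × v ≡ v′) ⊎ (u ≡ v′ × v ≡ u′)

Legal : ∀ {n} → Labeling n → Vertex n → ℕ → Set
Legal {n} f v ℓ =
  f v ≡ nothing × ℓ ≤ edges n × (∀ w → f w ≢ just ℓ) × DistinctEdgeLabels (update f v ℓ)

Complete : ∀ {n} → Labeling n → Set
Complete f = ∀ v → f v ≢ nothing

data Player : Set where
  alice bob : Player

-- BobWins n p f : from position f with player p to move, Bob has a winning
-- strategy (the game is finite, so a well-founded strategy tree).
-- Bob wins iff the game ends (the player to move has no legal move) with
-- the graph not completely labeled.
data BobWins (n : ℕ) : Player → Labeling n → Set where
  alice-turn : ∀ {f} → ¬ Complete f →
               (∀ v ℓ → Legal f v ℓ → BobWins n bob (update f v ℓ)) →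
               BobWins n alice f
  bob-stuck  : ∀ {f} → ¬ Complete f → (∀ v ℓ → ¬ Legal f v ℓ) → BobWins n bob f
  bob-move   : ∀ {f} v ℓ → Legal f v ℓ → BobWins n alice (update f v ℓ) →
               BobWins n bob f

{-# OPTIONS --safe #-}
-- Write m for the number of edges.  In a graceful labeling every difference 1, …, m occurs on an edge,
-- so Bob wins as soon as some difference k is dead, i.e. no continuation of the game can produce it.
--
-- Translations of the hypercube and the complement c ↦ m − c preserve the game, so Alice's first label x
-- may be assumed to be at most m/2.  If x > 0, Bob puts 0 on a vertex z adjacent to hers.  From then on
-- Bob puts i = 1, 2, … on free neighbours of z, and Alice has to answer i with m − i on a neighbour of z
-- (m itself answers 0): all other pairs of labels with difference m − i already sit on neighbours of z,
-- no two of which are adjacent.  If Alice does not comply, Bob wastes m − i on a vertex not adjacent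
-- to z.  Eventually the neighbours of z are exhausted (or i turns out to be Alice's own first
-- label x), and m − i is dead after Bob's next move.
--
-- From dimension 4 on there is always room to waste a label legally; Q₂ and Q₃ are settled by an
-- exhaustive search for short wins of Bob.
module Submission where

open import Defs
open import Data.Bool using (Bool; true; false; not; _xor_)
open import Data.Bool.Properties using (not-involutive; not-injective; not-¬; ¬-not) renaming (_≟_ to _≟B_)
open import Data.Empty using (⊥; ⊥-elim)
open import Data.Fin using (Fin; fromℕ<; punchOut)
open import Data.Fin.Properties using (injective⇒≤; punchOut-injective; fromℕ<-injective; +↔⊎; *↔×; 2↔Bool)
open import Data.List using (List; []; _∷_; length; filter; map; _++_)
open import Data.List.Properties using (filter-notAll; length-map)
open import Data.List.Membership.Propositional using (_∈_; lose)
open import Data.List.Membership.Propositional.Properties using (∈-filter⁺; ∈-map⁺; ∈-++⁺ˡ; ∈-++⁺ʳ)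
open import Data.List.Relation.Unary.Any using (Any; here; there; any?; satisfied)
open import Data.Maybe using (Maybe; just; nothing)
open import Data.Maybe.Properties using (just-injective) renaming (≡-dec to Maybe-≡-dec)
open import Data.Nat using (ℕ; zero; suc; pred; _+_; _*_; _^_; _∸_; _≤_; _<_; z≤n; s≤s; ∣_-_∣; _≟_; _≤?_; _<?_)
open import Data.Nat.Properties
open import Data.Product using (∃; _×_; _,_; proj₁; proj₂; uncurry; swap)
open import Data.Product.Function.NonDependent.Propositional using (_×-↔_)
open import Data.Sum using (_⊎_; inj₁; inj₂; [_,_]′)
open import Data.Sum.Function.Propositional using (_⊎-↔_)
open import Data.Unit using (⊤; tt)
open import Data.Vec using ([]; _∷_; replicate; zipWith)
open import Data.Vec.Properties using (∷-injective; ∷-injectiveˡ; ∷-injectiveʳ)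
open import Function using (_∘_; id; _↔_; Injective; mk↔ₛ′; Inverse)
open import Function.Bundles using (Injection)
open import Function.Properties.Inverse using (↔-trans; ↔⇒↣)
open import Relation.Binary.PropositionalEquality
open import Relation.Nullary using (¬_; Dec; yes; no; contradiction)
open import Relation.Nullary.Decidable using (map′; ¬?; _×-dec_; _⊎-dec_; _→-dec_; toWitness)

private
  variable
    n k ℓ : ℕ
    f : Labeling n
    u v w p q : Vertex n

-- Finite search

allVertices? : ∀ n {P : Vertex n → Set} → (∀ v → Dec (P v)) → Dec (∀ v → P v)
allVertices? zero    P? = map′ (λ { p [] → p }) (λ h → h []) (P? [])
allVertices? (suc n) P? = map′
  (λ { (h₀ , h₁) (false ∷ v) → h₀ v ; (h₀ , h₁) (true ∷ v) → h₁ v })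
  (λ h → h ∘ (false ∷_) , h ∘ (true ∷_))
  (allVertices? n (P? ∘ (false ∷_)) ×-dec allVertices? n (P? ∘ (true ∷_)))

anyVertex? : ∀ n {P : Vertex n → Set} → (∀ v → Dec (P v)) → Dec (∃ P)
anyVertex? zero    P? = map′ ([] ,_) (λ { ([] , p) → p }) (P? [])
anyVertex? (suc n) P? = map′
  [ (λ (v , p) → false ∷ v , p) , (λ (v , p) → true ∷ v , p) ]′
  (λ { (false ∷ v , p) → inj₁ (v , p) ; (true ∷ v , p) → inj₂ (v , p) })
  (anyVertex? n (P? ∘ (false ∷_)) ⊎-dec anyVertex? n (P? ∘ (true ∷_)))

all≤? : {P : ℕ → Set} → (∀ c → Dec (P c)) → ∀ b → Dec (∀ c → c ≤ b → P c)
all≤? P? zero    = map′ (λ { p zero z≤n → p }) (λ h → h 0 z≤n) (P? 0)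
all≤? {P} P? (suc b) = map′ to (λ h → h (suc b) ≤-refl , λ c → h c ∘ m≤n⇒m≤1+n)
  (P? (suc b) ×-dec all≤? P? b)
  where
  to : P (suc b) × (∀ c → c ≤ b → P c) → ∀ c → c ≤ suc b → P c
  to (p , h) c c≤ with m≤n⇒m<n∨m≡n c≤
  ... | inj₁ (s≤s c≤b) = h c c≤b
  ... | inj₂ refl      = p

any≤? : {P : ℕ → Set} → (∀ c → Dec (P c)) → ∀ b → Dec (∃ λ c → c ≤ b × P c)
any≤? P? zero    = map′ (λ p → 0 , z≤n , p) (λ { (zero , z≤n , p) → p }) (P? 0)
any≤? {P} P? (suc b) = map′
  [ (λ p → suc b , ≤-refl , p) , (λ (c , c≤b , p) → c , m≤n⇒m≤1+n c≤b , p) ]′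
  from (P? (suc b) ⊎-dec any≤? P? b)
  where
  from : (∃ λ c → c ≤ suc b × P c) → P (suc b) ⊎ (∃ λ c → c ≤ b × P c)
  from (c , c≤ , p) with m≤n⇒m<n∨m≡n c≤
  ... | inj₁ (s≤s c≤b) = inj₂ (c , c≤b , p)
  ... | inj₂ refl      = inj₁ p

allJust? : {P : ℕ → Set} → (∀ c → Dec (P c)) → (x : Maybe ℕ) → Dec (∀ c → x ≡ just c → P c)
allJust? P? (just c) = map′ (λ { p _ refl → p }) (λ h → h c refl) (P? c)
allJust? P? nothing  = yes λ _ ()

_≟M_ : (x y : Maybe ℕ) → Dec (x ≡ y)
_≟M_ = Maybe-≡-dec _≟_

isNothing? : (x : Maybe ℕ) → Dec (x ≡ nothing)
isNothing? (just _) = no λ ()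
isNothing? nothing  = yes refl

adj? : (u v : Vertex n) → Dec (Adj u v)
adj? []       []       = no λ ()
adj? (x ∷ u) (y ∷ v) with x ≟B y
... | yes refl = map′ there (λ { (here x≢x) → contradiction refl x≢x ; (there e) → e }) (adj? u v)
... | no x≢y   = map′ (λ { refl → here x≢y }) (λ { (here _) → refl ; (there _) → contradiction refl x≢y }) (u ≟V v)

allNeighbours? : (u : Vertex n) {P : Vertex n → Set} → (∀ v → Dec (P v)) → Dec (∀ v → Adj u v → P v)
allNeighbours? []      P? = yes λ _ ()
allNeighbours? (x ∷ u) {P} P? = map′ to
  (λ h → h _ (here (not-¬ refl)) , λ v e → h _ (there e))
  (P? (not x ∷ u) ×-dec allNeighbours? u (P? ∘ (x ∷_)))
  where
  to : P (not x ∷ u) × (∀ v → Adj u v → P (x ∷ v)) → ∀ v → Adj (x ∷ u) v → P v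
  to (p , h) (y ∷ _) (here x≢y) = subst (λ z → P (z ∷ u)) (sym (¬-not (x≢y ∘ sym))) p
  to (p , h) (_ ∷ v) (there e)  = h v e

SameEdge : (u v u′ v′ : Vertex n) → Set
SameEdge u v u′ v′ = (u ≡ u′ × v ≡ v′) ⊎ (u ≡ v′ × v ≡ u′)

-- Each hypothesis directly follows the variable that it restricts, so that the decision procedure
-- drops unlabelled vertices before it loops over a second edge.
DistinctAt : Labeling n → Vertex n → Set
DistinctAt {n} f u = ∀ a → f u ≡ just a → ∀ v → Adj u v → ∀ b → f v ≡ just b →
  ∀ u′ a′ → f u′ ≡ just a′ → ∀ v′ → Adj u′ v′ → ∀ b′ → f v′ ≡ just b′ →
  ∣ a - b ∣ ≡ ∣ a′ - b′ ∣ → SameEdge u v u′ v′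

distinctAt? : (f : Labeling n) (u : Vertex n) → Dec (DistinctAt f u)
distinctAt? {n} f u =
  allJust? (λ a → allNeighbours? u λ v → allJust? (λ b →
  allVertices? n λ u′ → allJust? (λ a′ → allNeighbours? u′ λ v′ → allJust? (λ b′ →
    (∣ a - b ∣ ≟ ∣ a′ - b′ ∣) →-dec
      ((u ≟V u′ ×-dec v ≟V v′) ⊎-dec (u ≟V v′ ×-dec v ≟V u′)))
  (f v′)) (f u′)) (f v)) (f u)

distinctEdgeLabels? : (f : Labeling n) → Dec (DistinctEdgeLabels f)
distinctEdgeLabels? {n} f = map′
  (λ h u v u′ v′ a b a′ b′ e e′ fu fv fu′ fv′ → h u a fu v e b fv u′ a′ fu′ v′ e′ b′ fv′)
  (λ h u a fu v e b fv u′ a′ fu′ v′ e′ b′ fv′ → h u v u′ v′ a b a′ b′ e e′ fu fv fu′ fv′)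
  (allVertices? n (distinctAt? f))

legal? : (f : Labeling n) (v : Vertex n) (ℓ : ℕ) → Dec (Legal f v ℓ)
legal? {n} f v ℓ = isNothing? (f v) ×-dec (ℓ ≤? edges n) ×-dec
  allVertices? n (λ w → ¬? (f w ≟M just ℓ)) ×-dec distinctEdgeLabels? (update f v ℓ)

-- Positions of the game

Adj-sym : Adj u v → Adj v u
Adj-sym (here x≢y) = here (x≢y ∘ sym)
Adj-sym (there e)  = there (Adj-sym e)

Adj-irrefl : ¬ Adj u u
Adj-irrefl (here x≢x) = x≢x refl
Adj-irrefl (there e)  = Adj-irrefl e

just≢nothing : ∀ {x : Maybe ℕ} {c} → x ≡ just c → x ≢ nothing
just≢nothing refl ()

update-same : (f : Labeling n) (v : Vertex n) → update f v ℓ v ≡ just ℓ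
update-same f v with v ≟V v
... | yes _  = refl
... | no v≢v = contradiction refl v≢v

update-other : (f : Labeling n) → w ≢ v → update f v ℓ w ≡ f w
update-other {w = w} {v = v} f w≢v with w ≟V v
... | yes w≡v = contradiction w≡v w≢v
... | no _    = refl

update-just : ∀ (f : Labeling n) v ℓ w {c} → update f v ℓ w ≡ just c →
              (w ≡ v × c ≡ ℓ) ⊎ (w ≢ v × f w ≡ just c)
update-just f v ℓ w eq with w ≟V v
... | yes w≡v = inj₁ (w≡v , sym (just-injective eq))
... | no w≢v  = inj₂ (w≢v , eq)

update-nothing : ∀ (f : Labeling n) v ℓ w → update f v ℓ w ≡ nothing → w ≢ v × f w ≡ nothing
update-nothing f v ℓ w eq with w ≟V v
... | no w≢v = w≢v , eq

update-keeps : ∀ {c} → f v ≡ nothing → f w ≡ just c → update f v ℓ w ≡ just c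
update-keeps {f = f} fv fw =
  trans (update-other f λ { refl → just≢nothing fw fv }) fw

-- `BobWins` speaks of arbitrary labelings, so what legal play guarantees is carried along as an
-- invariant.
record Valid {n} (f : Labeling n) : Set where
  field
    distinct  : DistinctEdgeLabels f
    injective : ∀ {u v a} → f u ≡ just a → f v ≡ just a → u ≡ v
    bounded   : ∀ {u a} → f u ≡ just a → a ≤ edges n

open Valid

empty-valid : Valid {n} empty
empty-valid .distinct _ _ _ _ _ _ _ _ _ _ ()
empty-valid .injective ()
empty-valid .bounded ()

update-valid : ∀ {f : Labeling n} {v ℓ} → Valid f → Legal f v ℓ → Valid (update f v ℓ)
update-valid _ (_ , _ , _ , d) .distinct = d
update-valid {f = f} {v} {ℓ} V (_ , _ , fresh , _) .injective {x} {y} eq eq′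
  with update-just f v ℓ x eq | update-just f v ℓ y eq′
... | inj₁ (refl , _)    | inj₁ (refl , _)    = refl
... | inj₁ (_ , refl)    | inj₂ (_ , fy)      = contradiction fy (fresh y)
... | inj₂ (_ , fx)      | inj₁ (_ , refl)    = contradiction fx (fresh x)
... | inj₂ (_ , fx)      | inj₂ (_ , fy)      = injective V fx fy
update-valid {f = f} {v} {ℓ} V (_ , ℓ≤ , _) .bounded {x} eq with update-just f v ℓ x eq
... | inj₁ (_ , refl) = ℓ≤
... | inj₂ (_ , fx)   = bounded V fx

module _ {f : Labeling n} {p : Vertex n} {ℓ : ℕ} where

  data UpdatedEdge (u v : Vertex n) (a b : ℕ) : Set where
    old  : f u ≡ just a → f v ≡ just b → UpdatedEdge u v a b
    newˡ : u ≡ p → f v ≡ just b → UpdatedEdge u v a b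
    newʳ : v ≡ p → f u ≡ just a → UpdatedEdge u v a b

  updatedEdge : ∀ {u v a b} → Adj u v → update f p ℓ u ≡ just a → update f p ℓ v ≡ just b →
                UpdatedEdge u v a b
  updatedEdge {u} {v} e eu ev with update-just f p ℓ u eu | update-just f p ℓ v ev
  ... | inj₁ (refl , _) | inj₁ (refl , _) = ⊥-elim (Adj-irrefl e)
  ... | inj₁ (u≡p , _)  | inj₂ (_ , fv)   = newˡ u≡p fv
  ... | inj₂ (_ , fu)   | inj₁ (v≡p , _)  = newʳ v≡p fu
  ... | inj₂ (_ , fu)   | inj₂ (_ , fv)   = old fu fv

  -- A new conflict must involve an edge at `p`. Exchanging the two edges, or the ends of an edge,
  -- brings it into the form that `DistinctAt` excludes.
  distinct-update : DistinctEdgeLabels f → DistinctAt (update f p ℓ) p → DistinctEdgeLabels (update f p ℓ)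
  distinct-update d at u v u′ v′ a b a′ b′ e e′ gu gv gu′ gv′ eq
    with updatedEdge e gu gv | updatedEdge e′ gu′ gv′
  ... | newˡ refl _ | _           = at a gu v e b gv u′ a′ gu′ v′ e′ b′ gv′ eq
  ... | newʳ refl _ | _           =
    [ inj₂ ∘ swap , inj₁ ∘ swap ]′ (at b gv u (Adj-sym e) a gu u′ a′ gu′ v′ e′ b′ gv′ (trans (∣-∣-comm b a) eq))
  ... | old _ _     | newˡ refl _ =
    [ (λ (x , y) → inj₁ (sym x , sym y)) , (λ (x , y) → inj₂ (sym y , sym x)) ]′
      (at a′ gu′ v′ e′ b′ gv′ u a gu v e b gv (sym eq))
  ... | old _ _     | newʳ refl _ =
    [ (λ (x , y) → inj₂ (sym x , sym y)) , (λ (x , y) → inj₁ (sym y , sym x)) ]′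
      (at b′ gv′ u′ (Adj-sym e′) a′ gu′ u a gu v e b gv (trans (∣-∣-comm b′ a′) (sym eq)))
  ... | old fu fv   | old fu′ fv′ = d u v u′ v′ a b a′ b′ e e′ fu fv fu′ fv′ eq

  -- Only `r` can be a labelled neighbour of `p`, so the move creates at most one edge label, namely
  -- `d`, and `d` has not occurred before.
  legal-leaf : Valid f → f p ≡ nothing → ℓ ≤ edges n → (∀ w → f w ≢ just ℓ) →
    (r : Vertex n) (d : ℕ) →
    (∀ q c → Adj p q → f q ≡ just c → q ≡ r × ∣ ℓ - c ∣ ≡ d) →
    (∀ u v a b → Adj u v → f u ≡ just a → f v ≡ just b → ∣ a - b ∣ ≢ d) →
    Legal f p ℓ
  legal-leaf V fp ℓ≤m unused r d leaf new = fp , ℓ≤m , unused , distinct-update (distinct V) at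
    where
    neighbour : ∀ {q c} → Adj p q → update f p ℓ q ≡ just c → f q ≡ just c
    neighbour e gq = trans (sym (update-other f λ { refl → Adj-irrefl e })) gq
    at : DistinctAt (update f p ℓ) p
    at x gp q e c gq u a gu v e′ b gv eq
      with refl ← just-injective (trans (sym gp) (update-same f p))
      with refl , dist ← leaf q c e (neighbour e gq)
      with updatedEdge e′ gu gv
    ... | newˡ refl fv = inj₁ (refl , sym (proj₁ (leaf v b e′ fv)))
    ... | newʳ refl fu = inj₂ (refl , sym (proj₁ (leaf u a (Adj-sym e′) fu)))
    ... | old fu fv    = contradiction (trans (sym eq) dist) (new u v a b e′ fu fv)

  legal-isolated : Valid f → f p ≡ nothing → ℓ ≤ edges n → (∀ w → f w ≢ just ℓ) →
    (∀ q c → Adj p q → f q ≢ just c) → Legal f p ℓ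
  -- suc (edges n) is not the label of any edge.
  legal-isolated V fp ℓ≤m unused isolated = legal-leaf V fp ℓ≤m unused p (suc (edges n))
    (λ q c e fq → contradiction fq (isolated q c e))
    (λ u v a b _ fu fv eq → <-irrefl eq (s≤s (≤-trans (∣m-n∣≤m⊔n a b) (⊔-lub (bounded V fu) (bounded V fv)))))

-- Every edge label occurs in a graceful labeling

-- Each undirected edge is listed once, directed from `false` to `true` in its flipped coordinate.
-- This makes the type countable by the recursion of `edges-suc`.
Edge : ℕ → Set
Edge zero    = ⊥
Edge (suc n) = Vertex n ⊎ (Bool × Edge n)

source target : Edge n → Vertex n
source {suc n} (inj₁ u)       = false ∷ u
source {suc n} (inj₂ (x , e)) = x ∷ source e
target {suc n} (inj₁ u)       = true ∷ u
target {suc n} (inj₂ (x , e)) = x ∷ target e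

source-target : (e : Edge n) → Adj (source e) (target e)
source-target {suc n} (inj₁ u)       = here λ ()
source-target {suc n} (inj₂ (x , e)) = there (source-target e)

source≢target : (e : Edge n) → source e ≢ target e
source≢target e eq = Adj-irrefl (subst (Adj _) (sym eq) (source-target e))

edge-injective : (e e′ : Edge n) → source e ≡ source e′ → target e ≡ target e′ → e ≡ e′
edge-injective {suc n} (inj₁ u) (inj₁ u′) eq _ = cong inj₁ (∷-injectiveʳ eq)
edge-injective {suc n} (inj₁ u) (inj₂ (x , e)) eq eq′ with trans (∷-injectiveˡ eq) (sym (∷-injectiveˡ eq′))
... | ()
edge-injective {suc n} (inj₂ (x , e)) (inj₁ u) eq eq′ with trans (sym (∷-injectiveˡ eq)) (∷-injectiveˡ eq′)
... | ()
edge-injective {suc n} (inj₂ (x , e)) (inj₂ (x′ , e′)) eq eq′ with ∷-injective eq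
... | refl , s≡ = cong (λ e → inj₂ (x , e)) (edge-injective e e′ s≡ (∷-injectiveʳ eq′))

-- The flipped coordinate is `false` at every source and `true` at every target, so no edge is
-- listed in both directions.
edge-antisym : (e e′ : Edge n) → source e ≡ target e′ → target e ≢ source e′
edge-antisym {suc n} (inj₁ u) (inj₁ u′) () _
edge-antisym {suc n} (inj₁ u) (inj₂ (x , e)) eq eq′ with trans (∷-injectiveˡ eq) (sym (∷-injectiveˡ eq′))
... | ()
edge-antisym {suc n} (inj₂ (x , e)) (inj₁ u) eq eq′ with trans (sym (∷-injectiveˡ eq)) (∷-injectiveˡ eq′)
... | ()
edge-antisym {suc n} (inj₂ (x , e)) (inj₂ (x′ , e′)) eq eq′ =
  edge-antisym e e′ (∷-injectiveʳ eq) (∷-injectiveʳ eq′)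

vertex-count : ∀ n → Fin (2 ^ n) ↔ Vertex n
vertex-count zero    = mk↔ₛ′ (λ _ → []) (λ _ → Fin.zero) (λ { [] → refl }) (λ { Fin.zero → refl ; (Fin.suc ()) })
vertex-count (suc n) = ↔-trans *↔× (↔-trans (2↔Bool ×-↔ vertex-count n)
  (mk↔ₛ′ (uncurry _∷_) (λ { (x ∷ u) → x , u }) (λ { (x ∷ u) → refl }) (λ _ → refl)))

edges-suc : ∀ n → edges (suc n) ≡ 2 ^ n + 2 * edges n
edges-suc zero    = refl
edges-suc (suc n) = cong (2 ^ suc n +_)
  (trans (*-comm (suc n) (2 * 2 ^ n)) (trans (*-assoc 2 (2 ^ n) (suc n)) (cong (2 *_) (*-comm (2 ^ n) (suc n)))))

edge-count : ∀ n → Fin (edges n) ↔ Edge n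
edge-count zero    = mk↔ₛ′ (λ ()) (λ ()) (λ ()) (λ ())
edge-count (suc n) = subst (λ m → Fin m ↔ Edge (suc n)) (sym (edges-suc n))
  (↔-trans +↔⊎ (vertex-count n ⊎-↔ ↔-trans *↔× (2↔Bool ×-↔ edge-count n)))

-- Pigeonhole principle: lowering the values by one and punching out the missed one would inject
-- `Fin (suc m)` into `Fin m`.
injective⇒onto : ∀ {m} (g : Fin m → ℕ) → Injective _≡_ _≡_ g →
  (∀ j → 1 ≤ g j × g j ≤ m) → ∀ k → 1 ≤ k → k ≤ m → ¬ (∀ j → g j ≢ k)
injective⇒onto {suc m} g g-inj range (suc k) _ k<m miss =
  1+n≰n (injective⇒≤ {f = λ j → punchOut (h≢k j)} λ {x} {y} eq →
    h-inj (punchOut-injective (h≢k x) (h≢k y) eq))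
  where
  pred< : ∀ j → pred (g j) < suc m
  pred< j with g j | range j
  ... | suc _ | _ , lt = lt
  h : Fin (suc m) → Fin (suc m)
  h j = fromℕ< (pred< j)
  pred-inj : ∀ {x y} → 1 ≤ x → 1 ≤ y → pred x ≡ pred y → x ≡ y
  pred-inj (s≤s _) (s≤s _) = cong suc
  h-inj : ∀ {x y} → h x ≡ h y → x ≡ y
  h-inj {x} {y} eq = g-inj (pred-inj (proj₁ (range x)) (proj₁ (range y))
    (fromℕ<-injective _ _ (pred< x) (pred< y) eq))
  h≢k : ∀ j → fromℕ< k<m ≢ h j
  h≢k j eq = miss j (pred-inj (proj₁ (range j)) (s≤s z≤n)
    (sym (fromℕ<-injective _ _ k<m (pred< j) eq)))

-- Dead edge labels

-- An upper estimate of where `c` may end up: legality of a later move is ignored, which keeps the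
-- notion monotone and easy to decide.
Avail : Labeling n → Vertex n → ℕ → Set
Avail f p c = f p ≡ just c ⊎ (f p ≡ nothing × (∀ w → f w ≢ just c))

-- The smaller label is named `c`. Both directions of an edge are covered because `p` and `q` range
-- over ordered pairs.
Dead : Labeling n → ℕ → Set
Dead {n} f k = ∀ c p q → c + k ≤ edges n → Adj p q → Avail f p c → ¬ Avail f q (c + k)

avail-update : ∀ {c} → Legal f v ℓ → Avail (update f v ℓ) p c → Avail f p c
avail-update {f = f} {v} {ℓ} {p} (fv , _ , fresh , _) (inj₁ eq) with update-just f v ℓ p eq
... | inj₁ (refl , refl) = inj₂ (fv , fresh)
... | inj₂ (_ , fp)      = inj₁ fp
avail-update {f = f} {v} {ℓ} {p} (fv , _) (inj₂ (eq , unused)) =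
  inj₂ (proj₂ (update-nothing f v ℓ p eq) , λ w fw → unused w (update-keeps {f = f} fv fw))

dead-update : Legal f v ℓ → Dead f k → Dead (update f v ℓ) k
dead-update lg d c p q ≤m e ap aq = d c p q ≤m e (avail-update lg ap) (avail-update lg aq)

avail-position : ∀ {c} → Valid f → f w ≡ just c → Avail f p c → p ≡ w
avail-position V fw (inj₁ fp)           = injective V fp fw
avail-position V fw (inj₂ (_ , unused)) = contradiction fw (unused _)

complete-label : {f : Labeling n} → Complete f → ∀ v → ∃ λ a → f v ≡ just a
complete-label {f = f} complete v with f v in eq
... | just a  = a , refl
... | nothing = contradiction eq (complete v)

-- In a complete valid position the `edges n` distinct edge labels lie between 1 and `edges n`,
-- hence exhaust that range. The edge with label `k` would then contradict `Dead`.
dead⇒¬complete : {f : Labeling n} → Valid f → 1 ≤ k → k ≤ edges n → Dead f k → ¬ Complete f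
dead⇒¬complete {n} {k} {f} V 1≤k k≤m dead complete =
  injective⇒onto (label ∘ Inverse.to (edge-count n))
    (λ eq → Injection.injective (↔⇒↣ (edge-count n)) (label-injective eq))
    (λ j → label-range (Inverse.to (edge-count n) j)) k 1≤k k≤m
    (λ j → label≢k (Inverse.to (edge-count n) j))
  where
  at : Vertex n → ℕ
  at v = proj₁ (complete-label complete v)
  at-just : ∀ v → f v ≡ just (at v)
  at-just v = proj₂ (complete-label complete v)
  label : Edge n → ℕ
  label e = ∣ at (source e) - at (target e) ∣
  label-injective : ∀ {e e′} → label e ≡ label e′ → e ≡ e′
  label-injective {e} {e′} eq
    with distinct V _ _ _ _ _ _ _ _ (source-target e) (source-target e′)
           (at-just _) (at-just _) (at-just _) (at-just _) eq
  ... | inj₁ (s≡s , t≡t) = edge-injective e e′ s≡s t≡t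
  ... | inj₂ (s≡t , t≡s) = contradiction t≡s (edge-antisym e e′ s≡t)
  label-range : ∀ e → 1 ≤ label e × label e ≤ edges n
  label-range e =
    n≢0⇒n>0 (λ eq → source≢target e (injective V (at-just _)
      (trans (at-just _) (cong just (sym (∣m-n∣≡0⇒m≡n eq)))))) ,
    ≤-trans (∣m-n∣≤m⊔n (at (source e)) (at (target e))) (⊔-lub (bounded V (at-just _)) (bounded V (at-just _)))
  ordered : ∀ {u v} → Adj u v → at u ≤ at v → ∣ at u - at v ∣ ≢ k
  ordered {u} {v} e u≤v eq = dead (at u) u v (subst (_≤ edges n) (sym sum) (bounded V (at-just v))) e
    (inj₁ (at-just u)) (inj₁ (trans (at-just v) (cong just (sym sum))))
    where
    sum : at u + k ≡ at v
    sum = trans (cong (at u +_) (trans (sym eq) (m≤n⇒∣m-n∣≡n∸m u≤v))) (m+[n∸m]≡n u≤v)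
  label≢k : ∀ e → label e ≢ k
  label≢k e with ≤-total (at (source e)) (at (target e))
  ... | inj₁ s≤t = ordered (source-target e) s≤t
  ... | inj₂ t≤s = ordered (Adj-sym (source-target e)) t≤s ∘ trans (∣-∣-comm (at (target e)) (at (source e)))

-- Bounds the number of free vertices in `P` without counting them: the list may contain repetitions
-- and irrelevant vertices.
Cover : (Vertex n → Set) → ℕ → Labeling n → Set
Cover P k f = ∃ λ L → length L ≤ k × (∀ v → P v → f v ≡ nothing → v ∈ L)

cover-zero : {P : Vertex n → Set} → Cover P 0 f → P v → f v ≢ nothing
cover-zero ([] , _ , cov) pv fv with cov _ pv fv
... | ()

cover-suc : {P : Vertex n → Set} → Cover P (suc k) f → P v → f v ≡ nothing → Cover P k (update f v ℓ)
cover-suc {f = f} {v} {ℓ} (L , len , cov) pv fv =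
  filter ≢v? L ,
  ≤-pred (≤-trans (filter-notAll ≢v? L (lose (cov v pv fv) λ v≢v → v≢v refl)) len) ,
  λ w pw eq → let w≢v , fw = update-nothing f v ℓ w eq in ∈-filter⁺ ≢v? (cov w pw fw) w≢v
  where
  ≢v? : ∀ w → Dec (w ≢ v)
  ≢v? w = ¬? (w ≟V v)

vertices : ∀ n → List (Vertex n)
vertices zero    = [] ∷ []
vertices (suc n) = map (false ∷_) (vertices n) ++ map (true ∷_) (vertices n)

∈-vertices : (v : Vertex n) → v ∈ vertices n
∈-vertices []          = here refl
∈-vertices (false ∷ v) = ∈-++⁺ˡ (∈-map⁺ (false ∷_) (∈-vertices v))
∈-vertices {suc n} (true ∷ v) = ∈-++⁺ʳ (map (false ∷_) (vertices n)) (∈-map⁺ (true ∷_) (∈-vertices v))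

module _ {n} {k : ℕ} (1≤k : 1 ≤ k) (k≤m : k ≤ edges n) where

  any-move? : (f : Labeling n) → Dec (∃ λ v → ∃ λ ℓ → ℓ ≤ edges n × Legal f v ℓ)
  any-move? f = anyVertex? n λ v → any≤? (legal? f v) (edges n)

  private
    dead-wins : ∀ {f} j p → Cover (λ _ → ⊤) j f → Valid f → Dead f k → BobWins n p f
    dead-wins {f} zero alice cov V d = alice-turn (dead⇒¬complete V 1≤k k≤m d)
      λ v ℓ lg → contradiction (proj₁ lg) (cover-zero {f = f} cov tt)
    dead-wins {f} (suc j) alice cov V d = alice-turn (dead⇒¬complete V 1≤k k≤m d)
      λ v ℓ lg → dead-wins j bob (cover-suc {f = f} cov tt (proj₁ lg)) (update-valid V lg) (dead-update {f = f} lg d)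
    dead-wins {f} j bob cov V d with any-move? f
    dead-wins {f} j bob cov V d | no stuck =
      bob-stuck (dead⇒¬complete V 1≤k k≤m d) λ v ℓ lg → stuck (v , ℓ , proj₁ (proj₂ lg) , lg)
    dead-wins {f} zero bob cov V d | yes (v , ℓ , _ , lg) =
      contradiction (proj₁ lg) (cover-zero {f = f} cov tt)
    dead-wins {f} (suc j) bob cov V d | yes (v , ℓ , _ , lg) =
      bob-move v ℓ lg (dead-wins j alice (cover-suc {f = f} cov tt (proj₁ lg)) (update-valid V lg) (dead-update {f = f} lg d))

  -- From here on any legal move serves Bob. The play ends because the free vertices run out, and it
  -- cannot end in a complete labeling.
  dead⇒bobWins : ∀ {f} p → Valid f → Dead f k → BobWins n p f
  dead⇒bobWins p = dead-wins (length (vertices n)) p (vertices n , ≤-refl , λ v _ _ → ∈-vertices v)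

-- Symmetries of the game

module Symmetry {n : ℕ}
  (σ : Vertex n → Vertex n) (σ-involutive : ∀ v → σ (σ v) ≡ v)
  (σ-adj : ∀ {u v} → Adj u v → Adj (σ u) (σ v))
  (ρ : ℕ → ℕ) (ρ-bounded : ∀ {a} → a ≤ edges n → ρ a ≤ edges n)
  (ρ-involutive : ∀ {a} → a ≤ edges n → ρ (ρ a) ≡ a)
  (ρ-isometric : ∀ {a b} → a ≤ edges n → b ≤ edges n → ∣ ρ a - ρ b ∣ ≡ ∣ a - b ∣) where

  Bounded : Labeling n → Set
  Bounded f = ∀ u a → f u ≡ just a → a ≤ edges n

  Image : Labeling n → Labeling n → Set
  Image f g = ∀ v a → f v ≡ just a → g (σ v) ≡ just (ρ a)

  -- A relation instead of an equation, since labelings are functions and agree only pointwise.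
  -- Having images in both directions makes free vertices correspond too, and as `σ` and `ρ` are
  -- involutions the relation is symmetric.
  record Related (f g : Labeling n) : Set where
    constructor related
    field
      boundedˡ : Bounded f
      boundedʳ : Bounded g
      imageˡ   : Image f g
      imageʳ   : Image g f

  open Related

  flip : ∀ {f g} → Related f g → Related g f
  flip (related bf bg i j) = related bg bf j i

  σ-injective : ∀ {u v} → σ u ≡ σ v → u ≡ v
  σ-injective eq = trans (sym (σ-involutive _)) (trans (cong σ eq) (σ-involutive _))

  related-nothing : ∀ {f g} → Related f g → ∀ {v} → f v ≡ nothing → g (σ v) ≡ nothing
  related-nothing {f} {g} R {v} fv with g (σ v) in eq
  ... | nothing = refl
  ... | just a  = contradiction fv (just≢nothing (trans (cong f (sym (σ-involutive v))) (imageʳ R _ _ eq)))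

  related-complete : ∀ {f g} → Related f g → Complete g → Complete f
  related-complete R complete v fv = complete (σ v) (related-nothing R fv)

  related-distinct : ∀ {f g} → Related f g → DistinctEdgeLabels f → DistinctEdgeLabels g
  related-distinct R d u v u′ v′ a b a′ b′ e e′ gu gv gu′ gv′ eq
    with d _ _ _ _ _ _ _ _ (σ-adj e) (σ-adj e′) (imageʳ R _ _ gu) (imageʳ R _ _ gv) (imageʳ R _ _ gu′) (imageʳ R _ _ gv′)
           (trans (ρ-isometric (boundedʳ R _ _ gu) (boundedʳ R _ _ gv)) (trans eq (sym (ρ-isometric (boundedʳ R _ _ gu′) (boundedʳ R _ _ gv′)))))
  ... | inj₁ (x , y) = inj₁ (σ-injective x , σ-injective y)
  ... | inj₂ (x , y) = inj₂ (σ-injective x , σ-injective y)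

  update-bounded : ∀ {f} v {ℓ} → ℓ ≤ edges n → Bounded f → Bounded (update f v ℓ)
  update-bounded {f} v {ℓ} ℓ≤ bf u _ eq with update-just f v ℓ u eq
  ... | inj₁ (_ , refl) = ℓ≤
  ... | inj₂ (_ , fu)   = bf _ _ fu

  update-image : ∀ {f g v ℓ} → Image f g → Image (update f v ℓ) (update g (σ v) (ρ ℓ))
  update-image {f} {g} {v} {ℓ} im w a eq with update-just f v ℓ w eq
  ... | inj₁ (refl , refl) = update-same g (σ v)
  ... | inj₂ (w≢v , fw)    = trans (update-other g (w≢v ∘ σ-injective)) (im w a fw)

  update-related : ∀ {f g v ℓ} → ℓ ≤ edges n → Related f g → Related (update f v ℓ) (update g (σ v) (ρ ℓ))
  update-related {f} {g} {v} {ℓ} ℓ≤ (related bf bg i j) = related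
    (update-bounded v ℓ≤ bf) (update-bounded (σ v) (ρ-bounded ℓ≤) bg) (update-image {f} {g} i)
    (subst₂ (λ x a → Image (update g (σ v) (ρ ℓ)) (update f x a)) (σ-involutive v) (ρ-involutive ℓ≤)
      (update-image {g} {f} j))

  related-legal : ∀ {f g v ℓ} → Related f g → Legal f v ℓ → Legal g (σ v) (ρ ℓ)
  related-legal {f} {g} {v} {ℓ} R (fv , ℓ≤ , fresh , d) =
    related-nothing R fv , ρ-bounded ℓ≤ ,
    (λ w gw → fresh (σ w) (trans (imageʳ R w _ gw) (cong just (ρ-involutive ℓ≤)))) ,
    related-distinct (update-related ℓ≤ R) d

  -- The strategy tree is copied: Alice's moves in `g` are pulled back to `f`, and Bob's replies in
  -- `f` are carried over to `g`.
  related-bobWins : ∀ {f g p} → Related f g → BobWins n p f → BobWins n p g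
  related-bobWins R (alice-turn inc next) = alice-turn (inc ∘ related-complete R) λ v ℓ lg →
    related-bobWins (flip (update-related (proj₁ (proj₂ lg)) (flip R))) (next (σ v) (ρ ℓ) (related-legal (flip R) lg))
  related-bobWins R (bob-stuck inc stuck) = bob-stuck (inc ∘ related-complete R) λ v ℓ lg →
    stuck (σ v) (ρ ℓ) (related-legal (flip R) lg)
  related-bobWins R (bob-move v ℓ lg win) = bob-move (σ v) (ρ ℓ) (related-legal R lg)
    (related-bobWins (update-related (proj₁ (proj₂ lg)) R) win)

_⊕_ : Vertex n → Vertex n → Vertex n
_⊕_ = zipWith _xor_

⊕-involutive : (t v : Vertex n) → t ⊕ (t ⊕ v) ≡ v
⊕-involutive []          []      = refl
⊕-involutive (false ∷ t) (x ∷ v) = cong (x ∷_) (⊕-involutive t v)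
⊕-involutive (true ∷ t)  (x ∷ v) = cong₂ _∷_ (not-involutive x) (⊕-involutive t v)

-- The translation by `u ⊕ v` takes `u` to `v`, so any two first vertices are equivalent.
⊕-transitive : (u v : Vertex n) → (u ⊕ v) ⊕ u ≡ v
⊕-transitive []      []      = refl
⊕-transitive (x ∷ u) (y ∷ v) = cong₂ _∷_ (lemma x y) (⊕-transitive u v)
  where
  lemma : ∀ x y → (x xor y) xor x ≡ y
  lemma false false = refl
  lemma false true  = refl
  lemma true  false = refl
  lemma true  true  = refl

⊕-adj : (t : Vertex n) → Adj u v → Adj (t ⊕ u) (t ⊕ v)
⊕-adj (false ∷ t) (here x≢y) = here x≢y
⊕-adj (true ∷ t)  (here x≢y) = here (x≢y ∘ not-injective)
⊕-adj (x ∷ t)     (there e)  = there (⊕-adj t e)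

-- Adding `a + b` to both entries removes the truncated subtractions.
complement-isometric : ∀ {m a b} → a ≤ m → b ≤ m → ∣ m ∸ a - m ∸ b ∣ ≡ ∣ a - b ∣
complement-isometric {m} {a} {b} a≤m b≤m = begin
  ∣ m ∸ a - m ∸ b ∣                     ≡⟨ ∣m+n-m+o∣≡∣n-o∣ (a + b) (m ∸ a) (m ∸ b) ⟨
  ∣ a + b + (m ∸ a) - a + b + (m ∸ b) ∣ ≡⟨ cong₂ ∣_-_∣ left right ⟩
  ∣ m + b - m + a ∣                     ≡⟨ ∣m+n-m+o∣≡∣n-o∣ m b a ⟩
  ∣ b - a ∣                             ≡⟨ ∣-∣-comm b a ⟩
  ∣ a - b ∣                             ∎
  where
  open ≡-Reasoning
  left : a + b + (m ∸ a) ≡ m + b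
  left = trans (cong (_+ (m ∸ a)) (+-comm a b)) (trans (+-assoc b a (m ∸ a))
    (trans (cong (b +_) (m+[n∸m]≡n a≤m)) (+-comm b m)))
  right : a + b + (m ∸ b) ≡ m + a
  right = trans (+-assoc a b (m ∸ b)) (trans (cong (a +_) (m+[n∸m]≡n b≤m)) (+-comm a m))

module _ {n : ℕ} (reply : ∀ x → x + x ≤ edges n → ∃ λ a → BobWins n bob (update empty a x)) where

  private
    first-image : (σ : Vertex n → Vertex n) (ρ : ℕ → ℕ) {u v : Vertex n} {x y : ℕ} → σ u ≡ v → ρ x ≡ y →
      ∀ w a → update empty u x w ≡ just a → update empty v y (σ w) ≡ just (ρ a)
    first-image σ ρ {u} {x = x} refl refl w a eq with update-just empty u x w eq
    ... | inj₁ (refl , refl) = update-same empty (σ u)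

    first-bounded : ∀ (v : Vertex n) {x} → x ≤ edges n → ∀ u a → update empty v x u ≡ just a → a ≤ edges n
    first-bounded v {x} x≤m u _ eq with update-just empty v x u eq
    ... | inj₁ (_ , refl) = x≤m

  -- The vertex `a` supplied by `reply` may depend on the label; a translation takes it to the
  -- vertex that Alice actually chose.
  alice-first : BobWins n alice empty
  alice-first = alice-turn (λ complete → complete (replicate n false) refl) λ v x lg → answer v x (proj₁ (proj₂ lg))
    where
    answer : ∀ v x → x ≤ edges n → BobWins n bob (update empty v x)
    answer v x x≤m with x + x ≤? edges n
    ... | yes small =
      let a , win = reply x small
          τ = a ⊕ v
          back = trans (cong (τ ⊕_) (sym (⊕-transitive a v))) (⊕-involutive τ a)
      in Symmetry.related-bobWins (τ ⊕_) (⊕-involutive τ) (⊕-adj τ) id id (λ _ → refl) (λ _ _ → refl)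
           (Symmetry.related (first-bounded a x≤m) (first-bounded v x≤m)
             (first-image (τ ⊕_) id (⊕-transitive a v) refl) (first-image (τ ⊕_) id back refl)) win
    ... | no large =
      let y = edges n ∸ x
          y≤m = m∸n≤m (edges n) x
          -- More than half of the labels lie below `x`, so its complement `y` is at most `x`, and
          -- `y + y` is at most `y + x`, the number of edges.
          y≤x = ≤-trans (∸-monoˡ-≤ x (≰⇒≥ large)) (≤-reflexive (m+n∸n≡m x x))
          a , win = reply y (≤-trans (+-monoʳ-≤ y y≤x) (≤-reflexive (m∸n+n≡m x≤m)))
          τ = a ⊕ v
          back = trans (cong (τ ⊕_) (sym (⊕-transitive a v))) (⊕-involutive τ a)
      in Symmetry.related-bobWins (τ ⊕_) (⊕-involutive τ) (⊕-adj τ)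
           (edges n ∸_) (λ {b} _ → m∸n≤m (edges n) b) m∸[m∸n]≡n complement-isometric
           (Symmetry.related (first-bounded a y≤m) (first-bounded v x≤m)
             (first-image (τ ⊕_) (edges n ∸_) (⊕-transitive a v) (m∸[m∸n]≡n x≤m))
             (first-image (τ ⊕_) (edges n ∸_) back refl)) win

-- The identity symmetry, used in place of function extensionality.
bobWins-ext : ∀ {f g : Labeling n} {p} → Valid f → f ≗ g → BobWins n p f → BobWins n p g
bobWins-ext V f≗g = Symmetry.related-bobWins id (λ _ → refl) id id id (λ _ → refl) (λ _ _ → refl)
  (Symmetry.related (λ _ _ → bounded V) (λ u _ gu → bounded V (trans (f≗g u) gu))
    (λ v _ → trans (sym (f≗g v))) (λ v _ → trans (f≗g v)))

-- Exhaustive search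

-- Iterated updates are slow to evaluate, so the search works on tables.
data Table : ℕ → Set where
  leaf : Maybe ℕ → Table zero
  node : Table n → Table n → Table (suc n)

⟦_⟧ : Table n → Labeling n
⟦ leaf x ⟧ []            = x
⟦ node l r ⟧ (false ∷ v) = ⟦ l ⟧ v
⟦ node l r ⟧ (true ∷ v)  = ⟦ r ⟧ v

emptyTable : ∀ n → Table n
emptyTable zero    = leaf nothing
emptyTable (suc n) = node (emptyTable n) (emptyTable n)

emptyTable-correct : (v : Vertex n) → empty v ≡ ⟦ emptyTable n ⟧ v
emptyTable-correct []          = refl
emptyTable-correct (false ∷ v) = emptyTable-correct v
emptyTable-correct (true ∷ v)  = emptyTable-correct v

set : Table n → Vertex n → ℕ → Table n
set (leaf _)   []          ℓ = leaf (just ℓ)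
set (node l r) (false ∷ v) ℓ = node (set l v ℓ) r
set (node l r) (true ∷ v)  ℓ = node l (set r v ℓ)

set-same : (T : Table n) (v : Vertex n) → ⟦ set T v ℓ ⟧ v ≡ just ℓ
set-same (leaf _)   []          = refl
set-same (node l r) (false ∷ v) = set-same l v
set-same (node l r) (true ∷ v)  = set-same r v

set-other : (T : Table n) → w ≢ v → ⟦ set T v ℓ ⟧ w ≡ ⟦ T ⟧ w
set-other {w = []}        {[]}        (leaf _)   w≢v = contradiction refl w≢v
set-other {w = false ∷ w} {false ∷ v} (node l r) w≢v = set-other l (w≢v ∘ cong (false ∷_))
set-other {w = true ∷ w}  {true ∷ v}  (node l r) w≢v = set-other r (w≢v ∘ cong (true ∷_))
set-other {w = false ∷ w} {true ∷ v}  (node l r) w≢v = refl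
set-other {w = true ∷ w}  {false ∷ v} (node l r) w≢v = refl

set-correct : ∀ {f : Labeling n} (T : Table n) → f ≗ ⟦ T ⟧ → ∀ v → update f v ℓ ≗ ⟦ set T v ℓ ⟧
set-correct T f≗T v w with w ≟V v
... | yes refl = sym (set-same T v)
... | no w≢v   = trans (f≗T w) (sym (set-other T w≢v))

distinct-ext : ∀ {f g : Labeling n} → f ≗ g → DistinctEdgeLabels f → DistinctEdgeLabels g
distinct-ext f≗g d u v u′ v′ a b a′ b′ e e′ gu gv gu′ gv′ =
  d u v u′ v′ a b a′ b′ e e′ (trans (f≗g u) gu) (trans (f≗g v) gv) (trans (f≗g u′) gu′) (trans (f≗g v′) gv′)

valid-ext : ∀ {f g : Labeling n} → f ≗ g → Valid f → Valid g
valid-ext f≗g V .distinct        = distinct-ext f≗g (distinct V)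
valid-ext f≗g V .injective gu gv = injective V (trans (f≗g _) gu) (trans (f≗g _) gv)
valid-ext f≗g V .bounded gu      = bounded V (trans (f≗g _) gu)

Unused : Labeling n → ℕ → Set
Unused f c = ∀ w → f w ≢ just c

unused? : (f : Labeling n) (c : ℕ) → Dec (Unused f c)
unused? {n} f c = allVertices? n λ w → ¬? (f w ≟M just c)

-- Distinctness is tested only at the new vertex; by `distinct-update` this is enough in a valid
-- position.
LegalMove : Table n → Vertex n → ℕ → Set
LegalMove {n} T v ℓ = ⟦ T ⟧ v ≡ nothing × ℓ ≤ edges n × Unused ⟦ T ⟧ ℓ × DistinctAt ⟦ set T v ℓ ⟧ v

legalMove? : (T : Table n) (v : Vertex n) (ℓ : ℕ) → Dec (LegalMove T v ℓ)
legalMove? {n} T v ℓ = isNothing? (⟦ T ⟧ v) ×-dec (ℓ ≤? edges n) ×-dec unused? ⟦ T ⟧ ℓ ×-dec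
  distinctAt? ⟦ set T v ℓ ⟧ v

legal⇒legalMove : (T : Table n) → Legal ⟦ T ⟧ v ℓ → LegalMove T v ℓ
legal⇒legalMove {v = v} T (free , ℓ≤m , unused , d) = free , ℓ≤m , unused ,
  λ a gv w e b gw u′ a′ gu′ v′ e′ b′ gv′ →
    d v w u′ v′ a b a′ b′ e e′ (trans (eq v) gv) (trans (eq w) gw) (trans (eq u′) gu′) (trans (eq v′) gv′)
  where
  eq = set-correct T (λ _ → refl) v

legalMove⇒legal : (T : Table n) → Valid ⟦ T ⟧ → LegalMove T v ℓ → Legal ⟦ T ⟧ v ℓ
legalMove⇒legal {v = v} T V (free , ℓ≤m , unused , at) = free , ℓ≤m , unused , distinct-update (distinct V)
  λ a gv w e b gw u′ a′ gu′ v′ e′ b′ gv′ →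
    at a (trans (eq v) gv) w e b (trans (eq w) gw) u′ a′ (trans (eq u′) gu′) v′ e′ b′ (trans (eq v′) gv′)
  where
  eq = sym ∘ set-correct T (λ _ → refl) v

availFrom? : (f : Labeling n) {c : ℕ} → Dec (Unused f c) → (p : Vertex n) → Dec (Avail f p c)
availFrom? f {c} un? p = (f p ≟M just c) ⊎-dec (isNothing? (f p) ×-dec un?)

dead? : (f : Labeling n) (k : ℕ) → Dec (Dead f k)
dead? {n} f k = map′
  (λ h c p q c+k≤m e ap → h c (m+n≤o⇒m≤o∸n c c+k≤m) c+k≤m p ap q e)
  (λ h c _ c+k≤m p ap q e → h c p q c+k≤m e ap)
  -- The guard on `c + k` also handles `k` beyond `edges n`, where the truncated bound still admits
  -- `c` equal to 0.
  (all≤? (λ c → (c + k ≤? edges n) →-dec disjoint? c (unused? f c) (unused? f (c + k))) (edges n ∸ k))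
  where
  -- The two decisions are arguments in order to be evaluated only once.
  disjoint? : ∀ c → Dec (Unused f c) → Dec (Unused f (c + k)) →
              Dec (∀ p → Avail f p c → ∀ q → Adj p q → ¬ Avail f q (c + k))
  disjoint? c un? un?′ = allVertices? n λ p → availFrom? f un? p →-dec
    allNeighbours? p λ q → ¬? (availFrom? f un?′ q)

-- Only the three largest edge labels are tested: this suffices for Q₂ and Q₃.
Lost : Labeling n → Set
Lost {n} f = ∃ λ j → j ≤ 2 × 1 ≤ edges n ∸ j × Dead f (edges n ∸ j)

lost? : (f : Labeling n) → Dec (Lost f)
lost? {n} f = any≤? (λ j → (1 ≤? edges n ∸ j) ×-dec dead? f (edges n ∸ j)) 2

lost⇒bobWins : ∀ {f : Labeling n} p → Valid f → Lost f → BobWins n p f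
lost⇒bobWins {n} p V (j , _ , 1≤k , dead) = dead⇒bobWins 1≤k (m∸n≤m (edges n) j) p V dead

-- The labels tried by Bob: they suffice for Q₂ and Q₃.
candidates : ℕ → List ℕ
candidates m = m ∷ 1 ∷ 2 ∷ 3 ∷ 4 ∷ m ∸ 1 ∷ []

-- d bounds the number of further moves that Bob needs until an edge label is dead.
BobWinsIn AliceLosesIn : ℕ → Table n → Set
BobWinsIn zero        T = Lost ⟦ T ⟧
BobWinsIn {n} (suc d) T = BobWinsIn d T ⊎
  Any (λ ℓ → ∃ λ v → LegalMove T v ℓ × AliceLosesIn d (set T v ℓ)) (candidates (edges n))
AliceLosesIn zero        T = Lost ⟦ T ⟧
AliceLosesIn {n} (suc d) T = Lost ⟦ T ⟧ ⊎ ((∃ λ v → ⟦ T ⟧ v ≡ nothing) ×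
  (∀ v ℓ → ℓ ≤ edges n → LegalMove T v ℓ → BobWinsIn (suc d) (set T v ℓ)))

bobWinsIn?    : ∀ d (T : Table n) → Dec (BobWinsIn d T)
aliceLosesIn? : ∀ d (T : Table n) → Dec (AliceLosesIn d T)
bobWinsIn? zero        T = lost? ⟦ T ⟧
bobWinsIn? {n} (suc d) T = bobWinsIn? d T ⊎-dec
  any? (λ ℓ → anyVertex? n λ v → legalMove? T v ℓ ×-dec aliceLosesIn? d (set T v ℓ)) (candidates (edges n))
aliceLosesIn? zero        T = lost? ⟦ T ⟧
aliceLosesIn? {n} (suc d) T = lost? ⟦ T ⟧ ⊎-dec (anyVertex? n (λ v → isNothing? (⟦ T ⟧ v)) ×-dec
  allVertices? n λ v → all≤? (λ ℓ → legalMove? T v ℓ →-dec bobWinsIn? (suc d) (set T v ℓ)) (edges n))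

module _ (T : Table n) {v : Vertex n} {ℓ : ℕ} (V : Valid ⟦ T ⟧) (lg : Legal ⟦ T ⟧ v ℓ) where

  set-valid : Valid ⟦ set T v ℓ ⟧
  set-valid = valid-ext (set-correct T (λ _ → refl) v) (update-valid V lg)

  set-bobWins : ∀ {p} → BobWins n p ⟦ set T v ℓ ⟧ → BobWins n p (update ⟦ T ⟧ v ℓ)
  set-bobWins = bobWins-ext set-valid (sym ∘ set-correct T (λ _ → refl) v)

bobWinsIn⇒bobWins    : ∀ d (T : Table n) → Valid ⟦ T ⟧ → BobWinsIn d T → BobWins n bob ⟦ T ⟧
aliceLosesIn⇒bobWins : ∀ d (T : Table n) → Valid ⟦ T ⟧ → AliceLosesIn d T → BobWins n alice ⟦ T ⟧
bobWinsIn⇒bobWins zero    T V lost       = lost⇒bobWins bob V lost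
bobWinsIn⇒bobWins (suc d) T V (inj₁ win) = bobWinsIn⇒bobWins d T V win
bobWinsIn⇒bobWins (suc d) T V (inj₂ some) with ℓ , v , mv , loses ← satisfied some =
  bob-move v ℓ lg (set-bobWins T V lg (aliceLosesIn⇒bobWins d (set T v ℓ) (set-valid T V lg) loses))
  where lg = legalMove⇒legal T V mv
aliceLosesIn⇒bobWins zero    T V lost        = lost⇒bobWins alice V lost
aliceLosesIn⇒bobWins (suc d) T V (inj₁ lost) = lost⇒bobWins alice V lost
aliceLosesIn⇒bobWins (suc d) T V (inj₂ ((w , fw) , next)) = alice-turn (λ complete → complete w fw) λ v ℓ lg →
  set-bobWins T V lg (bobWinsIn⇒bobWins (suc d) (set T v ℓ) (set-valid T V lg)
    (next v ℓ (proj₁ (proj₂ lg)) (legal⇒legalMove T lg)))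

-- Bob's first move is prescribed, which shortens the search and permits the label 0, absent from
-- `candidates`.
Opening : ℕ → Table n → Vertex n → ℕ → Set
Opening d T v ℓ = LegalMove T v ℓ × AliceLosesIn d (set T v ℓ)

opening? : ∀ d (T : Table n) v ℓ → Dec (Opening d T v ℓ)
opening? d T v ℓ = legalMove? T v ℓ ×-dec aliceLosesIn? d (set T v ℓ)

opening⇒bobWins : ∀ d {f : Labeling n} T v ℓ → f ≗ ⟦ T ⟧ → Valid f → Opening d T v ℓ → BobWins n bob f
opening⇒bobWins d {f} T v ℓ f≗T V (mv , loses) =
  bobWins-ext VT (sym ∘ f≗T) (bob-move v ℓ lg
    (set-bobWins T VT lg (aliceLosesIn⇒bobWins d (set T v ℓ) (set-valid T VT lg) loses)))
  where
  VT = valid-ext f≗T V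
  lg = legalMove⇒legal T VT mv

bobFirst : ∀ d v ℓ → Opening d (emptyTable n) v ℓ → BobWins n bob empty
bobFirst {n} d v ℓ = opening⇒bobWins d (emptyTable n) v ℓ emptyTable-correct empty-valid

first-valid : ∀ {v : Vertex n} {x} → x ≤ edges n → Valid (update empty v x)
first-valid x≤m = update-valid empty-valid (legal-isolated empty-valid refl x≤m (λ _ ()) (λ _ _ _ ()))

bobSecond : ∀ d (a v : Vertex n) ℓ x → x + x ≤ edges n →
            Opening d (set (emptyTable n) a x) v ℓ → BobWins n bob (update empty a x)
bobSecond {n} d a v ℓ x 2x≤m = opening⇒bobWins d (set (emptyTable n) a x) v ℓ
  (set-correct (emptyTable n) emptyTable-correct a) (first-valid (≤-trans (m≤m+n x x) 2x≤m))

-- The square and the three-dimensional cube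

half : ∀ {x k} → x + x ≤ 2 * k → x ≤ k
half {x} {k} 2x≤2k = *-cancelˡ-≤ 2 (subst (_≤ 2 * k) (cong (x +_) (sym (+-identityʳ x))) 2x≤2k)

square-bob-first : BobWins 2 bob empty
square-bob-first = bobFirst 2 (false ∷ false ∷ []) 1
  (toWitness {a? = opening? 2 (emptyTable 2) (false ∷ false ∷ []) 1} _)

-- With 3 opposite to `x`, the two remaining corners are not adjacent. If `x` is positive, both 0
-- and 4 would have to go there, so 4 is dead. If `x` is 0, the same holds for 1 and 4, while 0 and
-- 3 are opposite, so 3 is dead.
square-bob-second : ∀ x → x + x ≤ edges 2 → ∃ λ a → BobWins 2 bob (update empty a x)
square-bob-second x 2x≤4 = corner , bobSecond 0 corner (true ∷ true ∷ []) 3 x 2x≤4 (replies x (half 2x≤4))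
  where
  corner : Vertex 2
  corner = false ∷ false ∷ []
  replies : ∀ x → x ≤ 2 → Opening 0 (set (emptyTable 2) corner x) (true ∷ true ∷ []) 3
  replies = toWitness {a? = all≤? (λ x → opening? 0 (set (emptyTable 2) corner x) (true ∷ true ∷ []) 3) 2} _

origin₃ : Vertex 3
origin₃ = false ∷ false ∷ false ∷ []

cube-bob-first : BobWins 3 bob empty
cube-bob-first = bobFirst 2 origin₃ 0 (toWitness {a? = opening? 2 (emptyTable 3) origin₃ 0} _)

cube-bob-second : ∀ x → x + x ≤ edges 3 → ∃ λ a → BobWins 3 bob (update empty a x)
-- The edge label 12 needs 0 and 12 on adjacent vertices, but they are now antipodal.
cube-bob-second zero 0≤12 = origin₃ , bobSecond 0 origin₃ opposite 12 0 0≤12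
  (toWitness {a? = opening? 0 (set (emptyTable 3) origin₃ 0) opposite 12} _)
  where
  opposite : Vertex 3
  opposite = true ∷ true ∷ true ∷ []
cube-bob-second (suc x) 2x≤12 = neighbour , bobSecond 2 neighbour origin₃ 0 (suc x) 2x≤12 (replies x (≤-pred (half 2x≤12)))
  where
  neighbour : Vertex 3
  neighbour = true ∷ false ∷ false ∷ []
  replies : ∀ x → x ≤ 5 → Opening 2 (set (emptyTable 3) neighbour (suc x)) origin₃ 0
  replies = toWitness {a? = all≤? (λ x → opening? 2 (set (emptyTable 3) neighbour (suc x)) origin₃ 0) 5} _

-- Distances in the hypercube

dist : Vertex n → Vertex n → ℕ
dist []          []          = 0
dist (false ∷ u) (false ∷ v) = dist u v
dist (false ∷ u) (true ∷ v)  = suc (dist u v)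
dist (true ∷ u)  (false ∷ v) = suc (dist u v)
dist (true ∷ u)  (true ∷ v)  = dist u v

dist-self : (u : Vertex n) → dist u u ≡ 0
dist-self []          = refl
dist-self (false ∷ u) = dist-self u
dist-self (true ∷ u)  = dist-self u

-- Flipping one coordinate changes the Hamming distance by exactly one. This gives both the
-- bipartition and the Lipschitz bound used below.
dist-adj : (w : Vertex n) → Adj u v → dist w u ≡ suc (dist w v) ⊎ dist w v ≡ suc (dist w u)
dist-adj {u = false ∷ _} {false ∷ _} _           (here x≢x) = contradiction refl x≢x
dist-adj {u = true ∷ _}  {true ∷ _}  _           (here x≢x) = contradiction refl x≢x
dist-adj {u = false ∷ _} {true ∷ _}  (false ∷ w) (here _)   = inj₂ refl
dist-adj {u = false ∷ _} {true ∷ _}  (true ∷ w)  (here _)   = inj₁ refl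
dist-adj {u = true ∷ _}  {false ∷ _} (false ∷ w) (here _)   = inj₁ refl
dist-adj {u = true ∷ _}  {false ∷ _} (true ∷ w)  (here _)   = inj₂ refl
dist-adj {u = false ∷ _} (false ∷ w) (there e) = dist-adj w e
dist-adj {u = true ∷ _}  (true ∷ w)  (there e) = dist-adj w e
dist-adj {u = false ∷ _} (true ∷ w)  (there e) = [ inj₁ ∘ cong suc , inj₂ ∘ cong suc ]′ (dist-adj w e)
dist-adj {u = true ∷ _}  (false ∷ w) (there e) = [ inj₁ ∘ cong suc , inj₂ ∘ cong suc ]′ (dist-adj w e)

zeros : Vertex n
zeros {n} = replicate n false

weight : Vertex n → ℕ
weight = dist zeros

-- The vertex `zeros` is the one called z in the outline, where the label 0 sits.
Star : Vertex n → Set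
Star p = Adj zeros p

star-weight : Star p → weight p ≡ 1
star-weight {n} {p} e with dist-adj zeros e
... | inj₁ eq = contradiction (trans (sym (dist-self (zeros {n}))) eq) λ ()
... | inj₂ eq = trans eq (cong suc (dist-self (zeros {n})))

weight-adj : Adj u v → weight u ≢ weight v
weight-adj e eq with dist-adj zeros e
... | inj₁ eq′ = 1+n≢n (trans (sym eq′) eq)
... | inj₂ eq′ = 1+n≢n (trans (sym eq′) (sym eq))

weight-jump : Adj u v → weight u ≤ suc (weight v)
weight-jump e with dist-adj zeros e
... | inj₁ eq = ≤-reflexive eq
... | inj₂ eq = ≤-trans (n≤1+n _) (≤-trans (≤-reflexive (sym eq)) (n≤1+n _))

star-independent : Star p → Star q → ¬ Adj p q
star-independent sp sq e = weight-adj e (trans (star-weight sp) (sym (star-weight sq)))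

stars : ∀ n → List (Vertex n)
stars zero    = []
stars (suc n) = (true ∷ zeros) ∷ map (false ∷_) (stars n)

length-stars : ∀ n → length (stars n) ≡ n
length-stars zero    = refl
length-stars (suc n) = cong suc (trans (length-map (false ∷_) (stars n)) (length-stars n))

∈-stars : (p : Vertex n) → Star p → p ∈ stars n
∈-stars (false ∷ p) (here x≢x) = contradiction refl x≢x
∈-stars (true ∷ p)  (here _)   = here refl
∈-stars (_ ∷ p)     (there e)  = there (∈-map⁺ (false ∷_) (∈-stars p e))

-- Bob's strategy around the vertex labelled 0

module Strategy {n : ℕ} (a : Vertex n) (large : suc n < edges n)
  (far : Vertex n) (far-weight : 3 ≤ weight far) where

  private
    M : ℕ
    M = edges n

  -- Alice's first label x satisfies 2x ≤ M and sits at the vertex a.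
  Origin : ℕ → ℕ → Vertex n → ℕ → Set
  Origin s t p c = (c + c ≤ M × (c < s ⊎ p ≡ a)) ⊎ (∃ λ j → j < t × c + j ≡ M)

  -- The exchange so far: 1, ..., `s` - 1 and M - j for j below `t` are on neighbours of `zeros`, of
  -- which at most `k` are still free. Alice is to move when `s` is `t` + 1, Bob when `s` equals
  -- `t`. Each such move raises `s + t` by one and lowers `k` by one, which preserves `bound`.
  record State (s t k : ℕ) (f : Labeling n) : Set where
    field
      valid : Valid f
      zero₀ : f zeros ≡ just 0
      low   : ∀ c → 1 ≤ c → c < s → ∃ λ p → Star p × f p ≡ just c
      high  : ∀ c j → j < t → c + j ≡ M → ∃ λ p → Star p × f p ≡ just c
      near  : ∀ p c → f p ≡ just c → p ≡ zeros ⊎ (Star p × Origin s t p c)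
      cover : Cover Star k f
      bound : s + t + k ≤ suc n

  open State

  Safe : Vertex n → Set
  Safe p = ∀ q → Star q → ¬ Adj p q

  -- The part of `State` that survives wasted labels: low labels may lie anywhere away from the
  -- star, and other vertices are unrestricted.
  record Core (i : ℕ) (f : Labeling n) : Set where
    field
      zero₀ : f zeros ≡ just 0
      low   : ∀ c → 1 ≤ c → c ≤ i → ∃ λ p → Safe p × f p ≡ just c
      high  : ∀ c j → j < i → c + j ≡ M → ∃ λ p → Star p × f p ≡ just c

  -- The difference M - i arises only from c and c + (M - i) with c at most `i`. For positive c the
  -- larger label is M - (i - c), which sits on the star while c is safe. For c equal to 0 the label
  -- M - i would be needed on the star, which `none` excludes.
  core-dead : ∀ {i f} → Valid f → Core i f → i ≤ M →
              (∀ q → Star q → ¬ Avail f q (M ∸ i)) → Dead f (M ∸ i)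
  core-dead V C _ none zero p q _ e ap aq =
    none q (subst (λ p → Adj p q) (avail-position V (Core.zero₀ C) ap) e) aq
  core-dead {i} V C i≤M none c@(suc _) p q c+k≤M e ap aq
    = let p′ , safe , fp = Core.low C c (s≤s z≤n) c≤i
          q′ , star , fq = Core.high C (c + (M ∸ i)) (i ∸ c) (∸-monoʳ-< (s≤s z≤n) c≤i) sum
      in safe q′ star (subst₂ Adj (avail-position V fp ap) (avail-position V fq aq) e)
    where
    c≤i : c ≤ i
    c≤i = ≤-trans (m+n≤o⇒m≤o∸n c c+k≤M) (≤-reflexive (m∸[m∸n]≡n i≤M))
    sum : c + (M ∸ i) + (i ∸ c) ≡ M
    sum = trans (+-assoc c (M ∸ i) (i ∸ c)) (trans (cong (c +_) (+-comm (M ∸ i) (i ∸ c)))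
      (trans (sym (+-assoc c (i ∸ c) (M ∸ i))) (trans (cong (_+ (M ∸ i)) (m+[n∸m]≡n c≤i)) (m+[n∸m]≡n i≤M))))

  core-update : ∀ {i f v ℓ} → f v ≡ nothing → Core i f → Core i (update f v ℓ)
  core-update {f = f} fv C = record
    { zero₀ = update-keeps {f = f} fv (Core.zero₀ C)
    ; low   = λ c 1≤c c≤i → let p , safe , fp = Core.low C c 1≤c c≤i in p , safe , update-keeps {f = f} fv fp
    ; high  = λ c j j<i eq → let p , star , fp = Core.high C c j j<i eq in p , star , update-keeps {f = f} fv fp
    }

  core : ∀ {i k f} → State (suc i) i k f → Core i f
  core S = record
    { zero₀ = zero₀ S
    ; low   = λ c 1≤c c≤i → let p , star , fp = low S c 1≤c (s≤s c≤i) in p , (λ q → star-independent star) , fp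
    ; high  = high S
    }

  core-next : ∀ {i k f v ℓ} → State (suc i) (suc i) k f → f v ≡ nothing →
              (∃ λ p → Safe p × update f v ℓ p ≡ just (suc i)) → Core (suc i) (update f v ℓ)
  core-next {i} {f = f} {v} {ℓ} S fv new = record
    { zero₀ = update-keeps {f = f} fv (zero₀ S)
    ; low   = low′
    ; high  = λ c j j<i eq → let p , star , fp = high S c j j<i eq in p , star , update-keeps {f = f} fv fp
    }
    where
    low′ : ∀ c → 1 ≤ c → c ≤ suc i → ∃ λ p → Safe p × update f v ℓ p ≡ just c
    low′ c 1≤c c≤ with m≤n⇒m<n∨m≡n c≤
    ... | inj₂ refl = new
    ... | inj₁ c<   = let p , star , fp = low S c 1≤c c< in
      p , (λ q → star-independent star) , update-keeps {f = f} fv fp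

  dead-wins : ∀ {i f} p → Valid f → i < M → Dead f (M ∸ i) → BobWins n p f
  dead-wins {i} p V i<M = dead⇒bobWins (m<n⇒0<n∸m i<M) (m∸n≤m M i) p V

  -- M - j exceeds M/2, so it is neither a low label nor Alice's first one; the high labels already
  -- placed belong to smaller offsets.
  high-unused : ∀ {s t k f j} → State s t k f → t ≤ j → j + j < M → ∀ w → f w ≢ just (M ∸ j)
  high-unused {s} {t} {f = f} {j} S t≤j 2j<M w fw with near S w _ fw
  ... | inj₁ refl = contradiction (just-injective (trans (sym (zero₀ S)) fw))
    (<⇒≢ (m<n⇒0<n∸m (≤-<-trans (m≤m+n j j) 2j<M)))
  ... | inj₂ (_ , inj₁ (2c≤M , _)) = <⇒≱ 2j<M
    (≤-trans (≤-reflexive (sym sum)) (+-monoˡ-≤ j (+-cancelˡ-≤ (M ∸ j) _ _ (≤-trans 2c≤M (≤-reflexive (sym sum))))))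
    where
    sum : (M ∸ j) + j ≡ M
    sum = m∸n+n≡m (≤-trans (m≤m+n j j) (<⇒≤ 2j<M))
  ... | inj₂ (_ , inj₂ (j′ , j′<t , eq)) = <⇒≢ (<-≤-trans j′<t t≤j)
    (+-cancelˡ-≡ (M ∸ j) j′ j (trans eq (sym (m∸n+n≡m (≤-trans (m≤m+n j j) (<⇒≤ 2j<M))))))

  labelled-weight : ∀ {s t k f p c} → State s t k f → f p ≡ just c → weight p ≤ 1
  labelled-weight {p = p} {c} S fp with near S p c fp
  ... | inj₁ refl       = subst (_≤ 1) (sym (dist-self (zeros {n}))) z≤n
  ... | inj₂ (star , _) = ≤-reflexive (star-weight star)

  heavy-free : ∀ {s t k f p} → State s t k f → 2 ≤ weight p → f p ≡ nothing
  heavy-free {f = f} {p} S 2≤w with f p in eq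
  ... | nothing = refl
  ... | just c  = contradiction (≤-trans 2≤w (labelled-weight S eq)) λ { (s≤s ()) }

  heavy-not-star : ∀ {p : Vertex n} → 2 ≤ weight p → ¬ Star p
  heavy-not-star 2≤w star = contradiction (≤-trans 2≤w (≤-reflexive (star-weight star))) λ { (s≤s ()) }

  far-not-star : ¬ Star far
  far-not-star = heavy-not-star (≤-trans (n≤1+n 2) far-weight)

  far-isolated : ∀ {s t k f p q c} → State s t k f → 3 ≤ weight p → Adj p q → f q ≢ just c
  far-isolated S 3≤w e fq =
    contradiction (≤-trans 3≤w (≤-trans (weight-jump e) (s≤s (labelled-weight S fq)))) λ { (s≤s (s≤s ())) }

  far-safe : ∀ {p} → 3 ≤ weight p → Safe p
  far-safe 3≤w q star e =
    contradiction (≤-trans 3≤w (≤-trans (weight-jump e) (s≤s (≤-reflexive (star-weight star))))) λ { (s≤s (s≤s ())) }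

  far-legal : ∀ {s t k f ℓ} → State s t k f → ℓ ≤ M → (∀ w → f w ≢ just ℓ) → Legal f far ℓ
  far-legal S ℓ≤M unused = legal-isolated (valid S) (heavy-free S (≤-trans (n≤1+n 2) far-weight)) ℓ≤M unused
    λ q c e → far-isolated S far-weight e

  state-edge : ∀ {s t k f u v c d} → State s t k f → Adj u v → f u ≡ just c → f v ≡ just d →
               (c ≡ 0 × Star v) ⊎ (d ≡ 0 × Star u)
  state-edge {u = u} {v} {c} {d} S e fu fv with near S u c fu | near S v d fv
  ... | inj₁ refl     | _             = inj₁ (just-injective (trans (sym fu) (zero₀ S)) , e)
  ... | inj₂ _        | inj₁ refl     = inj₂ (just-injective (trans (sym fv) (zero₀ S)) , Adj-sym e)
  ... | inj₂ (su , _) | inj₂ (sv , _) = contradiction e (star-independent su sv)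

  -- Serves both halves of an exchange: Bob's low label raises `s`, Alice's high answer raises `t`.
  -- The two conditions say that `ℓ` is the only label added to the ranges.
  extend : ∀ {s t s′ t′ k f v ℓ} → State s t (suc k) f → Legal f v ℓ → Star v →
    s ≤ s′ → t ≤ t′ → (∀ c → s ≤ c → c < s′ → c ≡ ℓ) → (∀ c j → t ≤ j → j < t′ → c + j ≡ M → c ≡ ℓ) →
    Origin s′ t′ v ℓ → s′ + t′ + k ≤ suc n → State s′ t′ k (update f v ℓ)
  extend {s} {t} {s′} {t′} {k} {f} {v} {ℓ} S lg@(fv , _) star s≤s′ t≤t′ newLow newHigh origin b = record
    { valid = update-valid (valid S) lg
    ; zero₀ = update-keeps {f = f} fv (zero₀ S)
    ; low   = low′
    ; high  = high′
    ; near  = near′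
    ; cover = cover-suc {f = f} (cover S) star fv
    ; bound = b
    }
    where
    here′ : ∀ {c} → c ≡ ℓ → ∃ λ p → Star p × update f v ℓ p ≡ just c
    here′ refl = v , star , update-same f v
    low′ : ∀ c → 1 ≤ c → c < s′ → ∃ λ p → Star p × update f v ℓ p ≡ just c
    low′ c 1≤c c<s′ with c <? s
    ... | no c≮s  = here′ (newLow c (≮⇒≥ c≮s) c<s′)
    ... | yes c<s = let p , sp , fp = low S c 1≤c c<s in p , sp , update-keeps {f = f} fv fp
    high′ : ∀ c j → j < t′ → c + j ≡ M → ∃ λ p → Star p × update f v ℓ p ≡ just c
    high′ c j j<t′ eq with j <? t
    ... | no j≮t  = here′ (newHigh c j (≮⇒≥ j≮t) j<t′ eq)
    ... | yes j<t = let p , sp , fp = high S c j j<t eq in p , sp , update-keeps {f = f} fv fp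
    weaken : ∀ {p c} → Origin s t p c → Origin s′ t′ p c
    weaken (inj₁ (2c≤M , inj₁ c<s))  = inj₁ (2c≤M , inj₁ (<-≤-trans c<s s≤s′))
    weaken (inj₁ (2c≤M , inj₂ p≡a))  = inj₁ (2c≤M , inj₂ p≡a)
    weaken (inj₂ (j , j<t , eq))     = inj₂ (j , <-≤-trans j<t t≤t′ , eq)
    near′ : ∀ p c → update f v ℓ p ≡ just c → p ≡ zeros ⊎ (Star p × Origin s′ t′ p c)
    near′ p c eq with update-just f v ℓ p eq
    ... | inj₁ (refl , refl) = inj₂ (star , origin)
    ... | inj₂ (_ , fp) with near S p c fp
    ...   | inj₁ p≡0         = inj₁ p≡0
    ...   | inj₂ (sp , org)  = inj₂ (sp , weaken org)

  -- The condition on `f` is vacuous when Bob starts, and otherwise describes Alice's single label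
  -- at `a`.
  initial : ∀ {f} → Valid f → Legal f zeros 0 → (∀ p c → f p ≡ just c → p ≡ a × Star p × c + c ≤ M) →
            State 1 0 n (update f zeros 0)
  initial {f} V lg first = record
    { valid = update-valid V lg
    ; zero₀ = update-same f zeros
    ; low   = λ { _ (s≤s _) (s≤s ()) }
    ; high  = λ _ _ ()
    ; near  = near′
    ; cover = stars n , ≤-reflexive (length-stars n) , λ p sp _ → ∈-stars p sp
    ; bound = ≤-refl
    }
    where
    near′ : ∀ p c → update f zeros 0 p ≡ just c → p ≡ zeros ⊎ (Star p × Origin 1 0 p c)
    near′ p c eq with update-just f zeros 0 p eq
    ... | inj₁ (p≡0 , _) = inj₁ p≡0
    ... | inj₂ (_ , fp)  = let p≡a , sp , 2c≤M = first p c fp in inj₂ (sp , inj₁ (2c≤M , inj₂ p≡a))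

  -- Bob's answer when Alice does not put M ∸ i on a neighbour of zeros.
  Kill : Set
  Kill = ∀ {i k f b y q} → State (suc i) i k f → Legal f b y → Star q → update f b y q ≡ nothing →
         (∀ w → update f b y w ≢ just (M ∸ i)) →
         ∃ λ p → ¬ Star p × Legal (update f b y) p (M ∸ i)

  far-kill : ∀ {s t k f b y ℓ p} → State s t k f → Legal f b y → ℓ ≤ M → (∀ w → update f b y w ≢ just ℓ) →
             3 ≤ weight p → p ≢ b → ¬ Adj p b → ¬ Star p × Legal (update f b y) p ℓ
  far-kill {f = f} {b} {y} S lg ℓ≤M unused 3≤w p≢b ¬e = heavy-not-star 2≤w ,
    legal-isolated (update-valid (valid S) lg) (trans (update-other f p≢b) (heavy-free S 2≤w)) ℓ≤M unused
      λ q c e eq → [ (λ { (refl , _) → ¬e e }) , (λ (_ , fq) → far-isolated S 3≤w e fq) ]′ (update-just f b y q eq)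
    where
    2≤w = ≤-trans (n≤1+n 2) 3≤w

  freeStar? : (f : Labeling n) → Dec (∃ λ q → Star q × f q ≡ nothing)
  freeStar? f = anyVertex? n λ q → adj? zeros q ×-dec isNothing? (f q)

  module Play (kill : Kill) where

    double-bound : ∀ {i k} → suc i + i + k ≤ suc n → i + i < M
    double-bound {i} {k} le = ≤-<-trans (≤-trans (n≤1+n _) (≤-trans (m≤m+n (suc i + i) k) le)) large

    -- The continuation is called only after the expected answer M - i on the star; every other move
    -- leads to the death of M - i.
    alice-step : ∀ {i k f} → State (suc i) i k f →
      (∀ {k′ f′} → k ≡ suc k′ → State (suc i) (suc i) k′ f′ → BobWins n bob f′) → BobWins n alice f
    alice-step {i} {k} {f} S continue =
      alice-turn (λ complete → complete far (heavy-free S (≤-trans (n≤1+n 2) far-weight))) respond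
      where
      2i<M : i + i < M
      2i<M = double-bound {i} {k} (bound S)
      i<M : i < M
      i<M = ≤-<-trans (m≤m+n i i) 2i<M
      unused : ∀ w → f w ≢ just (M ∸ i)
      unused = high-unused S ≤-refl 2i<M

      dead : ∀ {f′} p → Valid f′ → Core i f′ → (∀ q → Star q → ¬ Avail f′ q (M ∸ i)) → BobWins n p f′
      dead p V C none = dead-wins p V i<M (core-dead V C (<⇒≤ i<M) none)

      proceed : ∀ k {b} → State (suc i) i k f → Legal f b (M ∸ i) → Star b →
        (∀ {k′ f′} → k ≡ suc k′ → State (suc i) (suc i) k′ f′ → BobWins n bob f′) →
        BobWins n bob (update f b (M ∸ i))
      proceed zero    S lg star continue = contradiction (proj₁ lg) (cover-zero {f = f} (cover S) star)
      proceed (suc k) S lg star continue = continue refl (extend S lg star ≤-refl (n≤1+n i)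
        (λ c s≤c c<s → contradiction c<s (≤⇒≯ s≤c))
        (λ { c j i≤j (s≤s j≤i) eq → trans (sym (m+n∸n≡m c j)) (cong₂ _∸_ eq (≤-antisym j≤i i≤j)) })
        (inj₂ (i , ≤-refl , m∸n+n≡m (<⇒≤ i<M)))
        (≤-trans (≤-reflexive (lemma i k)) (bound S)))
        where
        lemma : ∀ i k → suc i + suc i + k ≡ suc i + i + suc k
        lemma i k = trans (cong (_+ k) (+-suc (suc i) i)) (sym (+-suc (suc i + i) k))

      still-unused : ∀ {b y} → y ≢ M ∸ i → ∀ w → update f b y w ≢ just (M ∸ i)
      still-unused {b} {y} y≢ w eq with update-just f b y w eq
      ... | inj₁ (_ , eq′) = y≢ (sym eq′)
      ... | inj₂ (_ , fw)  = unused w fw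

      respond : ∀ b y → Legal f b y → BobWins n bob (update f b y)
      respond b y lg with y ≟ M ∸ i
      respond b y lg | yes refl with adj? zeros b
      ... | yes star = proceed k S lg star continue
      -- Alice herself has put M - i outside the star.
      ... | no ¬star = dead bob V′ (core-update (proj₁ lg) (core S)) λ q star aq →
        ¬star (subst Star (avail-position V′ (update-same f b) aq) star)
        where
        V′ = update-valid (valid S) lg
      respond b y lg | no y≢ with freeStar? (update f b y)
      -- The star is full without M - i, so nothing has to be wasted.
      ... | no full = dead bob V′ C′ λ
        { q star (inj₁ eq)       → still-unused y≢ q eq
        ; q star (inj₂ (fq , _)) → full (q , star , fq) }
        where
        V′ = update-valid (valid S) lg
        C′ = core-update {ℓ = y} (proj₁ lg) (core S)
      ... | yes (q , star , fq) = bob-move site (M ∸ i) lg″ (dead alice V″ (core-update (proj₁ lg″) C′) λ r sr ar →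
          ¬star (subst Star (avail-position V″ (update-same (update f b y) site) ar) sr))
        where
        C′ = core-update {ℓ = y} (proj₁ lg) (core S)
        killing = kill S lg star fq (still-unused y≢)
        site = proj₁ killing
        ¬star = proj₁ (proj₂ killing)
        lg″ = proj₂ (proj₂ killing)
        V″ = update-valid (update-valid (valid S) lg) lg″

    -- If `s` is already used, it is Alice's first label on the star, and wasting M - s kills that
    -- difference. Otherwise Bob puts `s` on a free star vertex. If there is none, `s` goes to
    -- `far`, and M - s has no place left next to `zeros`.
    bob-step : ∀ {i k f} → State (suc i) (suc i) k f →
      (∀ {k′ f′} → k ≡ suc k′ → State (suc (suc i)) (suc i) k′ f′ → BobWins n alice f′) → BobWins n bob f
    bob-step {i} {k} {f} S continue = choose (anyVertex? n λ w → f w ≟M just s)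
      where
      s : ℕ
      s = suc i
      2s<M : s + s < M
      2s<M = ≤-<-trans (≤-trans (m≤m+n (s + s) k) (bound S)) large
      s<M : s < M
      s<M = ≤-<-trans (m≤m+n s s) 2s<M

      dead : ∀ {f′} → Valid f′ → Core s f′ → (∀ q → Star q → ¬ Avail f′ q (M ∸ s)) → BobWins n alice f′
      dead V C none = dead-wins alice V s<M (core-dead V C (<⇒≤ s<M) none)

      fill : ∀ k {w} → State s s k f → (∀ w → f w ≢ just s) → Star w → f w ≡ nothing →
        (∀ {k′ f′} → k ≡ suc k′ → State (suc s) s k′ f′ → BobWins n alice f′) → BobWins n bob f
      fill zero    S unused star fw continue = contradiction fw (cover-zero {f = f} (cover S) star)
      fill (suc k) {w} S unused star fw continue = bob-move w s lg (continue refl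
        (extend S lg star (n≤1+n s) ≤-refl
          (λ { c s≤c (s≤s c≤s) → ≤-antisym c≤s s≤c })
          (λ c j t≤j j<t → contradiction j<t (≤⇒≯ t≤j))
          (inj₁ (<⇒≤ 2s<M , inj₁ ≤-refl))
          (≤-trans (≤-reflexive (sym (+-suc (s + s) k))) (bound S))))
        where
        pendant : ∀ q c → Adj w q → f q ≡ just c → q ≡ zeros × ∣ s - c ∣ ≡ s
        pendant q c e fq with near S q c fq
        ... | inj₁ refl rewrite just-injective (trans (sym fq) (zero₀ S)) = refl , refl
        ... | inj₂ (sq , _) = contradiction e (star-independent star sq)
        new : ∀ u v c d → Adj u v → f u ≡ just c → f v ≡ just d → ∣ c - d ∣ ≢ s
        new u v c d e fu fv eq with state-edge S e fu fv
        ... | inj₁ (refl , _) = unused v (trans fv (cong just eq))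
        ... | inj₂ (refl , _) = unused u (trans fu (cong just (trans (sym (∣-∣-identityʳ c)) eq)))
        lg : Legal f w s
        lg = legal-leaf (valid S) fw (<⇒≤ s<M) unused zeros s pendant new

      choose : Dec (∃ λ w → f w ≡ just s) → BobWins n bob f
      choose (yes (w , fw)) = bob-move far (M ∸ s) lg (dead V′
          (core-next S (proj₁ lg) (w , safe (near S w s fw) , update-keeps {f = f} (proj₁ lg) fw))
          λ q star aq → far-not-star
            (subst Star (avail-position V′ (update-same f far) aq) star))
        where
        lg : Legal f far (M ∸ s)
        lg = far-legal S (m∸n≤m M s) (high-unused S ≤-refl 2s<M)
        V′ = update-valid (valid S) lg
        safe : w ≡ zeros ⊎ (Star w × Origin s s w s) → Safe w
        safe (inj₁ refl)       = contradiction (just-injective (trans (sym (zero₀ S)) fw)) λ ()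
        safe (inj₂ (star , _)) q = star-independent star
      choose (no ¬used) with freeStar? f
      ... | yes (w , star , fw) = fill k S (λ w fw → ¬used (w , fw)) star fw continue
      ... | no full = bob-move far s lg (dead (update-valid (valid S) lg)
          (core-next S (proj₁ lg) (far , far-safe far-weight , update-same f far))
          λ { q star (inj₁ eq)       → labelled q eq
            ; q star (inj₂ (fq , _)) → full (q , star , proj₂ (update-nothing f far s q fq)) })
        where
        lg : Legal f far s
        lg = far-legal S (<⇒≤ s<M) λ w fw → ¬used (w , fw)
        labelled : ∀ q → update f far s q ≢ just (M ∸ s)
        labelled q eq with update-just f far s q eq
        ... | inj₁ (_ , eq′) = <⇒≢ 2s<M (trans (cong (_+ s) (sym eq′)) (m∸n+n≡m (<⇒≤ s<M)))
        ... | inj₂ (_ , fq)  = high-unused S ≤-refl 2s<M q fq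

    -- Every move that continues the exchange takes up a star vertex, hence the recursion on `k`.
    bob-to-move   : ∀ k {i f} → State (suc i) (suc i) k f → BobWins n bob f
    alice-to-move : ∀ k {i f} → State (suc i) i k f → BobWins n alice f
    bob-to-move zero    S = bob-step S λ ()
    bob-to-move (suc k) S = bob-step S λ { refl S′ → alice-to-move k S′ }
    alice-to-move zero    S = alice-step S λ ()
    alice-to-move (suc k) S = alice-step S λ { refl S′ → bob-to-move k S′ }

    start-legal : Legal {n} empty zeros 0
    start-legal = legal-isolated empty-valid refl z≤n (λ _ ()) λ _ _ _ ()

    start : State 1 0 n (update empty zeros 0)
    start = initial empty-valid start-legal λ _ _ ()

    bob-first : BobWins n bob empty
    bob-first = bob-move zeros 0 start-legal (alice-to-move n start)

    bob-second : Star a → ∀ x → x + x ≤ M → ∃ λ v → BobWins n bob (update empty v x)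
    -- Alice has played 0 herself, so M away from its neighbours kills the difference M at once.
    bob-second _ zero _ = zeros , bob-move far M lg (dead-wins {0} alice V′ (≤-<-trans z≤n large)
        (core-dead V′ (core-update (proj₁ lg) (core start)) z≤n λ q star aq →
          far-not-star
            (subst Star (avail-position V′ (update-same (update empty zeros 0) far) aq) star)))
      where
      lg : Legal (update empty zeros 0) far M
      lg = far-legal start ≤-refl (high-unused {j = 0} start z≤n (≤-<-trans z≤n large))
      V′ = update-valid (valid start) lg
    bob-second star x@(suc _) 2x≤M = a , bob-move zeros 0 lg (alice-to-move n (initial V lg only))
      where
      f₀ : Labeling n
      f₀ = update empty a x
      V : Valid f₀
      V = first-valid (≤-trans (m≤m+n x x) 2x≤M)
      at-a : ∀ p c → f₀ p ≡ just c → p ≡ a × c ≡ x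
      at-a p c eq with update-just empty a x p eq
      ... | inj₁ r = r
      only : ∀ p c → f₀ p ≡ just c → p ≡ a × Star p × c + c ≤ M
      only p c fp with refl , refl ← at-a p c fp = refl , star , 2x≤M
      zero-free : f₀ zeros ≡ nothing
      zero-free = update-other {w = zeros} {v = a} empty λ { refl → Adj-irrefl star }
      unused : ∀ w → f₀ w ≢ just 0
      unused w fw with () ← proj₂ (at-a w 0 fw)
      lg : Legal f₀ zeros 0
      lg = legal-leaf V zero-free z≤n unused a x (λ q c _ → at-a q c)
        λ u v c d e fu fv _ → Adj-irrefl (subst₂ Adj (proj₁ (at-a u c fu)) (proj₁ (at-a v d fv)) e)

-- Dimension at least four

module Setting (n : ℕ) where

  a : Vertex (4 + n)
  a = true ∷ zeros

  a-star : Star a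
  a-star = here λ ()

  far : Vertex (4 + n)
  far = false ∷ true ∷ true ∷ true ∷ zeros

  large : suc (4 + n) < edges (4 + n)
  large = begin
    2 + (4 + n)                ≤⟨ +-monoˡ-≤ (4 + n) {2} {4 + n} (s≤s (s≤s z≤n)) ⟩
    (4 + n) + (4 + n)          ≡⟨ cong ((4 + n) +_) (+-identityʳ (4 + n)) ⟨
    2 * (4 + n)                ≡⟨ *-comm 2 (4 + n) ⟩
    (4 + n) * 2                ≤⟨ *-monoʳ-≤ (4 + n) (^-monoʳ-≤ 2 {1} {3 + n} (s≤s z≤n)) ⟩
    (4 + n) * 2 ^ (3 + n)      ∎
    where open ≤-Reasoning

  open Strategy a large far (s≤s (s≤s (s≤s z≤n))) public

module HighDimension (n : ℕ) where

  open Setting (suc n)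

  -- Two vertices of weight 3 at distance 4, so Alice's last vertex cannot be equal or adjacent to
  -- both. This takes five coordinates.
  far₁ far₂ : Vertex (5 + n)
  far₁ = true ∷ true ∷ true ∷ false ∷ false ∷ zeros
  far₂ = false ∷ false ∷ true ∷ true ∷ true ∷ zeros

  close⇒dist≤1 : ∀ {m} (u v : Vertex m) → u ≡ v ⊎ Adj u v → dist u v ≤ 1
  close⇒dist≤1 u v (inj₁ refl) = subst (_≤ 1) (sym (dist-self u)) z≤n
  close⇒dist≤1 u v (inj₂ e) with dist-adj u e
  ... | inj₁ eq = contradiction (trans (sym (dist-self u)) eq) λ ()
  ... | inj₂ eq = ≤-reflexive (trans eq (cong suc (dist-self u)))

  close⇒dist≥3 : ∀ b → far₁ ≡ b ⊎ Adj far₁ b → 3 ≤ dist far₂ b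
  close⇒dist≥3 b (inj₁ refl) = s≤s (s≤s (s≤s z≤n))
  close⇒dist≥3 b (inj₂ e) with dist-adj far₂ e
  ... | inj₁ eq = ≤-trans (s≤s (s≤s (s≤s z≤n))) (≤-reflexive (suc-injective eq))
  ... | inj₂ eq = ≤-trans (s≤s (s≤s (s≤s z≤n))) (≤-reflexive (sym eq))

  close? : ∀ {m} (u v : Vertex m) → Dec (u ≡ v ⊎ Adj u v)
  close? u v = u ≟V v ⊎-dec adj? u v

  kill : Kill
  kill {i} {b = b} S lg _ _ unused with close? far₁ b
  ... | no ¬c = far₁ , far-kill S lg (m∸n≤m _ i) unused (s≤s (s≤s (s≤s z≤n))) (¬c ∘ inj₁) (¬c ∘ inj₂)
  ... | yes c = far₂ , far-kill S lg (m∸n≤m _ i) unused (s≤s (s≤s (s≤s z≤n))) (¬c ∘ inj₁) (¬c ∘ inj₂)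
    where
    ¬c : ¬ (far₂ ≡ b ⊎ Adj far₂ b)
    ¬c c′ = contradiction (≤-trans (close⇒dist≥3 b c) (close⇒dist≤1 far₂ b c′)) λ { (s≤s ()) }

  open Play kill public

module DimensionFour where

  open Setting 0
  open State

  ones : Vertex 4
  ones = true ∷ true ∷ true ∷ true ∷ []

  -- A vertex b other than ones leaves some vertex of weight 3 isolated.
  away : ∀ b → b ≡ ones ⊎ ∃ λ p → 3 ≤ weight p × p ≢ b × ¬ Adj p b
  away = toWitness {a? = allVertices? 4 λ b → b ≟V ones ⊎-dec anyVertex? 4 λ p →
    (3 ≤? weight p) ×-dec ¬? (p ≟V b) ×-dec ¬? (adj? p b)} _

  -- `w ⊕ q` is the fourth corner of the square through `zeros`, `w` and `q`.
  plane : ∀ (w : Vertex 4) → Star w → ∀ q → Star q → w ≢ q →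
          weight (w ⊕ q) ≡ 2 × (∀ z → Adj (w ⊕ q) z → Star z → z ≡ w ⊎ z ≡ q)
  plane = toWitness {a? = allNeighbours? (zeros {4}) λ w → allNeighbours? (zeros {4}) λ q → ¬? (w ≟V q) →-dec
    ((weight (w ⊕ q) ≟ 2) ×-dec allNeighbours? (w ⊕ q) λ z → adj? zeros z →-dec (z ≟V w ⊎-dec z ≟V q))} _

  middle : Vertex 4
  middle = false ∷ true ∷ true ∷ false ∷ []

  module _ {s t k : ℕ} {f : Labeling 4} {y : ℕ} (S : State s t k f) (lg : Legal f ones y) where

    -- The vertices of weight 2 are adjacent neither to zeros nor to ones.
    labelled-neighbour : ∀ {p q c} → weight p ≡ 2 → Adj p q → update f ones y q ≡ just c →
                         f q ≡ just c × Star q × Origin s t q c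
    labelled-neighbour {p} {q} {c} wp e eq with update-just f ones y q eq
    ... | inj₁ (refl , _) = contradiction (subst (4 ≤_) (cong suc wp) (weight-jump (Adj-sym e))) λ { (s≤s (s≤s (s≤s ()))) }
    ... | inj₂ (_ , fq) with near S q c fq
    ...   | inj₁ refl        = contradiction (subst (_≤ 1) wp (weight-jump e)) λ { (s≤s ()) }
    ...   | inj₂ (star , or) = fq , star , or

    labelled-edge : ∀ {u v c d} → Adj u v → update f ones y u ≡ just c → update f ones y v ≡ just d →
                    f u ≡ just c × f v ≡ just d
    labelled-edge e gu gv with updatedEdge {f = f} {ones} {y} e gu gv
    ... | old fu fv    = fu , fv
    ... | newˡ refl fv = contradiction fv (far-isolated S (s≤s (s≤s (s≤s z≤n))) e)
    ... | newʳ refl fu = contradiction fu (far-isolated S (s≤s (s≤s (s≤s z≤n))) (Adj-sym e))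

    plane-free : ∀ p → weight p ≡ 2 → update f ones y p ≡ nothing
    plane-free p wp = trans (update-other {w = p} {v = ones} f λ { refl → contradiction wp λ () }) (heavy-free S (≤-reflexive (sym wp)))

  -- Only `ones` spoils all vertices of weight 3. Then Bob wastes the label in weight 2, where star
  -- neighbours must be watched.
  kill : Kill
  kill {i} {k} {f} {b} {y} {q} S lg sq fq unused with away b
  ... | inj₂ (p , 3≤w , p≢b , ¬e) = p , far-kill S lg (m∸n≤m _ i) unused 3≤w p≢b ¬e
  -- The only label that can be on the star is Alice's first one at `a`, and `middle` is not
  -- adjacent to `a`.
  kill {zero} {k} {f} {_} {y} S lg _ _ unused | inj₁ refl = middle , (heavy-not-star ≤-refl) ,
    legal-isolated (update-valid (valid S) lg) (plane-free S lg middle refl) ≤-refl unused isolated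
    where
    isolated : ∀ q c → Adj middle q → update f ones y q ≢ just c
    isolated q c e eq with labelled-neighbour S lg refl e eq
    ... | fq , star , inj₁ (_ , inj₁ (s≤s z≤n)) =
      Adj-irrefl (subst (Adj zeros) (injective (valid S) fq (zero₀ S)) star)
    ... | _ , _ , inj₁ (_ , inj₂ refl) = toWitness {a? = ¬? (adj? middle a)} _ e
    ... | _ , _ , inj₂ (_ , () , _)
  -- Here M is 32. Bob puts 31 next to the vertex `w` labelled 1 and the free vertex `q`; the only
  -- new edge label is 30, which no vertex of the star carries.
  kill {suc zero} {k} {f} {_} {y} {q} S lg sq gq unused | inj₁ refl
    with w , sw , fw ← low S 1 ≤-refl ≤-refl =
    w ⊕ q , heavy-not-star (≤-reflexive (sym w2)) ,
    legal-leaf (update-valid (valid S) lg) (plane-free S lg (w ⊕ q) w2) (n≤1+n 31) unused w 30 pendant new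
    where
    fq : f q ≡ nothing
    fq = proj₂ (update-nothing f ones y q gq)
    square : weight (w ⊕ q) ≡ 2 × (∀ z → Adj (w ⊕ q) z → Star z → z ≡ w ⊎ z ≡ q)
    square = plane w sw q sq λ { refl → just≢nothing fw fq }
    w2 : weight (w ⊕ q) ≡ 2
    w2 = proj₁ square
    pendant : ∀ z c → Adj (w ⊕ q) z → update f ones y z ≡ just c → z ≡ w × ∣ 31 - c ∣ ≡ 30
    pendant z c e eq with fz , star , _ ← labelled-neighbour S lg {w ⊕ q} w2 e eq with proj₂ square z e star
    ... | inj₁ refl with refl ← just-injective (trans (sym fz) fw) = refl , refl
    ... | inj₂ refl = contradiction fq (just≢nothing fz)
    absent : ∀ {z} → f z ≢ just 30
    absent {z} fz with near S z 30 fz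
    ... | inj₁ refl = contradiction (trans (sym fz) (zero₀ S)) λ ()
    ... | inj₂ (_ , inj₁ (60≤32 , _)) = toWitness {a? = ¬? (60 ≤? 32)} _ 60≤32
    ... | inj₂ (_ , inj₂ (zero , _ , ()))
    ... | inj₂ (_ , inj₂ (suc _ , s≤s () , _))
    new : ∀ u v c d → Adj u v → update f ones y u ≡ just c → update f ones y v ≡ just d → ∣ c - d ∣ ≢ 30
    new u v c d e gu gv eq with fu , fv ← labelled-edge S lg e gu gv with state-edge S e fu fv
    ... | inj₁ (refl , _) = absent (trans fv (cong just eq))
    ... | inj₂ (refl , _) = absent (trans fu (cong just (trans (sym (∣-∣-identityʳ c)) eq)))
  -- From `i` equal to 2 on, `bound` leaves no free star vertex, contrary to `q`.
  kill {suc (suc zero)} {zero} {f} {_} {y} {q} S lg sq gq unused | inj₁ refl =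
    contradiction (proj₂ (update-nothing f ones y q gq)) (cover-zero {f = f} (cover S) sq)
  kill {suc (suc zero)} {suc k} S lg sq gq unused | inj₁ refl =
    contradiction (bound S) λ { (s≤s (s≤s (s≤s (s≤s (s≤s ()))))) }
  kill {suc (suc (suc i))} {k} S lg sq gq unused | inj₁ refl =
    contradiction (≤-trans six (bound S)) λ { (s≤s (s≤s (s≤s (s≤s (s≤s ()))))) }
    where
    six : 6 ≤ 4 + i + (3 + i) + k
    six = ≤-trans (+-mono-≤ (m≤m+n 4 i) (m≤m+n 2 (suc i))) (m≤m+n _ k)

  open Play kill public

theorem11 : ∀ (n : ℕ) → 2 ≤ n → BobWins n alice empty × BobWins n bob empty
theorem11 0 ()
theorem11 1 (s≤s ())
theorem11 2 _ = alice-first square-bob-second , square-bob-first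
theorem11 3 _ = alice-first cube-bob-second , cube-bob-first
theorem11 4 _ = alice-first (DimensionFour.bob-second (Setting.a-star 0)) , DimensionFour.bob-first
theorem11 (suc (suc (suc (suc (suc n))))) _ =
  alice-first (HighDimension.bob-second n (Setting.a-star (suc n))) , HighDimension.bob-first n
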